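{- Any two projection games $G$ and $H$ satisfy $$\|G\otimes H\|^2\le\varphi(\|G\|^2)\cdot\|H\|^2,\qquad\text{where }\varphi(x)=\frac{2\sqrt{x}}{1+x},$$ and $\|\cdot\|$ denotes the collision value of a game.
   Context: Projection games. A projection game $G$ is given by finite vertex sets $U,V$, a finite alphabet $\Sigma$, and a finite nonnegatively weighted bipartite multigraph between $U$ and $V$ whose edges carry constraints $\pi\subseteq\Sigma\times\Sigma$ such that for every $\beta\in\Sigma$ there is at most one $\alpha\in\Sigma$ with $(\alpha,\beta)\in\pi$. Choosing an edge with probability proportional to its weight gives a distribution on triples $(u,v,\pi)$, whose marginals are the probability measures on $U$ and $V$ (every vertex is assumed to have positive measure); $(v,\pi)|u$ denotes the distribution conditioned on $u$. Operator and collision value. $L(U\times\Sigma)$ is the space of functions $U\times\Sigma\to\mathbb{R}$ with $\|g\|^2=\mathbb{E}_u\sum_\alpha g(u,\alpha)^2$. $G$ is identified with the operator $L(V\times\Sigma)\to L(U\times\Sigma)$, $Gf(u,\alpha)=\mathbb{E}_{(v,\pi)|u}\sum_{\beta:(\alpha,\beta)\in\pi}f(v,\beta)$. An assignment is a nonnegative $f:V\times\Sigma\to\mathbb{R}$ with $\sum_\beta f(v,\beta)=1$ for all $v\in V$. The collision value of $G$ is $\|G\|=\max_f\|Gf\|$ over all assignments $f$. Products. For $G$ on $U,V,\Sigma$ and $H$ on $U',V',\Sigma'$, $G\otimes H$ is the projection game on $U\times U'$, $V\times V'$ with alphabet $\Sigma\times\Sigma'$: $(u,v,\pi)$ and $(u',v',\pi')$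 are drawn independently from $G$ and $H$, the edge joins $(u,u')$ and $(v,v')$, and answers $(\alpha,\alpha'),(\beta,\beta')$ satisfy the constraint iff $(\alpha,\beta)\in\pi$ and $(\alpha',\beta')\in\pi'$. Its operator is the tensor product of the two operators. -}

module Defs where

open import Level using (0ℓ)
open import Algebra.Bundles using (CommutativeRing)
open import Algebra.Structures using (IsCommutativeRing)
import Algebra.Properties.Semiring.Sum as SemiringSum
import Algebra.Solver.Ring.NaturalCoefficients.Default as SemiringSolver
open import Data.Bool.Base using (true; false; if_then_else_)
open import Data.Fin.Base using (Fin; zero; suc)
import Data.Fin.Properties as Fin
open import Data.Nat.Base using (ℕ; zero; suc) renaming (_*_ to _*ℕ_)
open import Data.Product.Base using (∃; ∃-syntax; _×_; _,_; proj₁; proj₂)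
open import Data.Product.Function.NonDependent.Propositional using (_×-↔_)
open import Data.Sum.Base using (_⊎_; inj₁; inj₂)
open import Data.Vec.Functional using () renaming (_∷_ to cons)
open import Function.Base using (_∘_)
open import Function.Bundles using (_↔_; Inverse)
open import Function.Construct.Composition using (_↔-∘_)
open import Function.Properties.Inverse using (Inverse⇒Injection; ↔-sym)
open import Relation.Binary.Core using (Rel)
open import Relation.Binary.Bundles using (Poset)
open import Relation.Binary.Definitions using (Decidable)
open import Relation.Binary.Structures using (IsDecTotalOrder)
import Relation.Binary.Construct.NonStrictToStrict as ToStrict
import Relation.Binary.Reasoning.PartialOrder as ≤-Reasoning
open import Relation.Binary.PropositionalEquality.Core as ≡ using (_≡_; _≗_)
open import Relation.Nullary using (¬_; Dec; yes; no; does; contradiction)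
open import Relation.Nullary.Decidable using (_×-dec_)

-- The library has no real numbers.  They are characterised up to isomorphism
-- as a Dedekind-complete ordered field, and everything below is stated for an
-- arbitrary such field.  The order is the classical one, hence decidable.
record CompleteOrderedField : Set₁ where
  infix  8 _⁻¹
  infixl 7 _*_
  infixl 6 _+_
  infix  4 _≈_ _≤_
  field
    Carrier           : Set
    _≈_               : Rel Carrier 0ℓ
    _≤_               : Rel Carrier 0ℓ
    _+_ _*_           : Carrier → Carrier → Carrier
    -_                : Carrier → Carrier
    0# 1#             : Carrier
    isCommutativeRing : IsCommutativeRing _≈_ _+_ _*_ -_ 0# 1#

    -- The value of 0# ⁻¹ is left unspecified.
    _⁻¹               : Carrier → Carrier
    ⁻¹-cong           : ∀ {x y} → x ≈ y → x ⁻¹ ≈ y ⁻¹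
    *-inverseʳ        : ∀ x → ¬ x ≈ 0# → x * x ⁻¹ ≈ 1#
    1≉0               : ¬ 1# ≈ 0#

    isDecTotalOrder   : IsDecTotalOrder _≈_ _≤_
    +-monoˡ-≤         : ∀ z {x y} → x ≤ y → x + z ≤ y + z
    *-nonneg          : ∀ {x y} → 0# ≤ x → 0# ≤ y → 0# ≤ x * y

  IsUpperBound : (Carrier → Set) → Carrier → Set
  IsUpperBound P b = ∀ x → P x → x ≤ b

  IsSupremum : (Carrier → Set) → Carrier → Set
  IsSupremum P s = IsUpperBound P s × (∀ b → IsUpperBound P b → s ≤ b)

  field
    supremum : ∀ P → ∃ P → ∃ (IsUpperBound P) → ∃ (IsSupremum P)

  commutativeRing : CommutativeRing 0ℓ 0ℓ
  commutativeRing = record { isCommutativeRing = isCommutativeRing }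

  open CommutativeRing commutativeRing public
    using ( semiring; commutativeSemiring; ring; setoid; refl; sym; trans
          ; +-cong; +-congˡ; +-congʳ; *-cong; *-congˡ; *-congʳ
          ; +-assoc; +-comm; +-identityˡ; +-identityʳ; -‿inverseˡ; -‿inverseʳ
          ; *-assoc; *-comm; *-identityˡ; *-identityʳ; zeroˡ; zeroʳ
          ; distribˡ; distribʳ)

  open IsDecTotalOrder isDecTotalOrder public
    using (_≟_; _≤?_; total; antisym; isPartialOrder)
    renaming (refl to ≤-refl; trans to ≤-trans; reflexive to ≤-reflexive)

  open ToStrict _≈_ _≤_ public using (_<_)

  open SemiringSum semiring public using (sum)

  infix 9 _²
  _² : Carrier → Carrier
  x ² = x * x

  private
    poset : Poset 0ℓ 0ℓ 0ℓ
    poset = record { isPartialOrder = isPartialOrder }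

    open ≤-Reasoning poset
    open SemiringSolver commutativeSemiring using (solve; _:=_; _:+_; _:*_)

  +-monoʳ-≤ : ∀ z {x y} → x ≤ y → z + x ≤ z + y
  +-monoʳ-≤ z {x} {y} x≤y = begin
    z + x  ≈⟨ +-comm z x ⟩
    x + z  ≤⟨ +-monoˡ-≤ z x≤y ⟩
    y + z  ≈⟨ +-comm y z ⟩
    z + y  ∎

  +-mono-≤ : ∀ {x y u v} → x ≤ y → u ≤ v → x + u ≤ y + v
  +-mono-≤ {y = y} {u = u} x≤y u≤v = ≤-trans (+-monoˡ-≤ u x≤y) (+-monoʳ-≤ y u≤v)

  +-nonneg : ∀ {x y} → 0# ≤ x → 0# ≤ y → 0# ≤ x + y
  +-nonneg {x} {y} 0≤x 0≤y = begin
    0#       ≈⟨ +-identityˡ 0# ⟨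
    0# + 0#  ≤⟨ +-mono-≤ 0≤x 0≤y ⟩
    x + y    ∎

  +-cancelʳ-≤ : ∀ z {x y} → x + z ≤ y + z → x ≤ y
  +-cancelʳ-≤ z {x} {y} h = begin
    x            ≈⟨ cancel x ⟩
    x + z + - z  ≤⟨ +-monoˡ-≤ (- z) h ⟩
    y + z + - z  ≈⟨ cancel y ⟨
    y            ∎
    where
    cancel : ∀ w → w ≈ w + z + - z
    cancel w = trans (sym (+-identityʳ w))
                 (trans (+-congˡ (sym (-‿inverseʳ z))) (sym (+-assoc w z (- z))))

  ≤⇒difference : ∀ {x y} → x ≤ y → ∃[ d ] (0# ≤ d × y ≈ x + d)
  ≤⇒difference {x} {y} x≤y = y + - x , 0≤d , y≈x+d
    where
    0≤d : 0# ≤ y + - x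
    0≤d = ≤-trans (≤-reflexive (sym (-‿inverseʳ x))) (+-monoˡ-≤ (- x) x≤y)
    y≈x+d : y ≈ x + (y + - x)
    y≈x+d = sym (trans (+-comm x (y + - x)) (trans (+-assoc y (- x) x)
              (trans (+-congˡ (-‿inverseˡ x)) (+-identityʳ y))))

  *-monoˡ-≤ : ∀ {z x y} → 0# ≤ z → x ≤ y → z * x ≤ z * y
  *-monoˡ-≤ {z} {x} {y} 0≤z x≤y with ≤⇒difference x≤y
  ... | d , 0≤d , y≈x+d = begin
    z * x          ≈⟨ +-identityʳ _ ⟨
    z * x + 0#     ≤⟨ +-monoʳ-≤ (z * x) (*-nonneg 0≤z 0≤d) ⟩
    z * x + z * d  ≈⟨ distribˡ z x d ⟨
    z * (x + d)    ≈⟨ *-congˡ y≈x+d ⟨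
    z * y          ∎

  x*y+x*y≤x²+y² : ∀ x y → x * y + x * y ≤ x ² + y ²
  x*y+x*y≤x²+y² x y with total x y
  ... | inj₁ x≤y = ordered x≤y
    where
    ordered : ∀ {x y} → x ≤ y → x * y + x * y ≤ x ² + y ²
    ordered {x} {y} x≤y with ≤⇒difference x≤y
    ... | d , 0≤d , y≈x+d = begin
      x * y + x * y                           ≈⟨ +-cong (*-congˡ y≈x+d) (*-congˡ y≈x+d) ⟩
      x * (x + d) + x * (x + d)               ≈⟨ +-identityʳ _ ⟨
      x * (x + d) + x * (x + d) + 0#          ≤⟨ +-monoʳ-≤ _ (*-nonneg 0≤d 0≤d) ⟩
      x * (x + d) + x * (x + d) + d * d       ≈⟨ solve 2 (λ x d → x :* (x :+ d) :+ x :* (x :+ d) :+ d :* d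
                                                   := x :* x :+ (x :+ d) :* (x :+ d)) refl x d ⟩
      x * x + (x + d) * (x + d)               ≈⟨ +-congˡ (*-cong y≈x+d y≈x+d) ⟨
      x ² + y ²                               ∎
  ... | inj₂ y≤x with ≤⇒difference y≤x
  ...   | d , 0≤d , x≈y+d = begin
      x * y + x * y                           ≈⟨ +-cong (*-congʳ x≈y+d) (*-congʳ x≈y+d) ⟩
      (y + d) * y + (y + d) * y               ≈⟨ +-identityʳ _ ⟨
      (y + d) * y + (y + d) * y + 0#          ≤⟨ +-monoʳ-≤ _ (*-nonneg 0≤d 0≤d) ⟩
      (y + d) * y + (y + d) * y + d * d       ≈⟨ solve 2 (λ y d → (y :+ d) :* y :+ (y :+ d) :* y :+ d :* d
                                                   := (y :+ d) :* (y :+ d) :+ y :* y) refl y d ⟩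
      (y + d) * (y + d) + y * y               ≈⟨ +-congʳ (*-cong x≈y+d x≈y+d) ⟨
      x ² + y ²                               ∎

  ²-nonneg : ∀ x → 0# ≤ x ²
  ²-nonneg x with total 0# x
  ... | inj₁ 0≤x = *-nonneg 0≤x 0≤x
  ... | inj₂ x≤0 with ≤⇒difference x≤0
  ...   | d , 0≤d , 0≈x+d = begin
      0#             ≤⟨ *-nonneg 0≤d 0≤d ⟩
      d * d          ≈⟨ +-identityˡ _ ⟨
      0# + d * d     ≈⟨ +-congʳ (trans (*-congˡ (sym 0≈x+d)) (zeroʳ x)) ⟨
      x * (x + d) + d * d
                     ≈⟨ solve 2 (λ x d → x :* (x :+ d) :+ d :* d := x :* x :+ (x :+ d) :* d) refl x d ⟩
      x * x + (x + d) * d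
                     ≈⟨ +-congˡ (trans (*-congʳ (sym 0≈x+d)) (zeroˡ d)) ⟩
      x * x + 0#     ≈⟨ +-identityʳ _ ⟩
      x ²            ∎

  0≤1 : 0# ≤ 1#
  0≤1 = ≤-trans (²-nonneg 1#) (≤-reflexive (*-identityˡ 1#))

  pos-respʳ-≤ : ∀ {x y} → 0# < x → x ≤ y → 0# < y
  pos-respʳ-≤ (0≤x , 0≉x) x≤y =
    ≤-trans 0≤x x≤y , λ 0≈y → 0≉x (antisym 0≤x (≤-trans x≤y (≤-reflexive (sym 0≈y))))

  *-pos : ∀ {x y} → 0# < x → 0# < y → 0# < x * y
  *-pos {x} {y} (0≤x , 0≉x) (0≤y , 0≉y) = *-nonneg 0≤x 0≤y , λ 0≈xy → 0≉y (begin-equality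
    0#                ≈⟨ zeroʳ (x ⁻¹) ⟨
    x ⁻¹ * 0#         ≈⟨ *-congˡ 0≈xy ⟩
    x ⁻¹ * (x * y)    ≈⟨ *-assoc _ _ _ ⟨
    (x ⁻¹ * x) * y    ≈⟨ *-congʳ (trans (*-comm _ _) (*-inverseʳ x (0≉x ∘ sym))) ⟩
    1# * y            ≈⟨ *-identityˡ y ⟩
    y                 ∎)

  ⁻¹-pos : ∀ {x} → 0# < x → 0# < x ⁻¹
  ⁻¹-pos {x} (0≤x , 0≉x) = 0≤x⁻¹ , λ 0≈x⁻¹ → 1≉0 (begin-equality
    1#         ≈⟨ *-inverseʳ x (0≉x ∘ sym) ⟨
    x * x ⁻¹   ≈⟨ *-congˡ 0≈x⁻¹ ⟨
    x * 0#     ≈⟨ zeroʳ x ⟩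
    0#         ∎)
    where
    0≤x⁻¹ : 0# ≤ x ⁻¹
    0≤x⁻¹ = begin
      0#                 ≤⟨ *-nonneg 0≤x (²-nonneg (x ⁻¹)) ⟩
      x * (x ⁻¹ * x ⁻¹)  ≈⟨ *-assoc _ _ _ ⟨
      (x * x ⁻¹) * x ⁻¹  ≈⟨ *-congʳ (*-inverseʳ x (0≉x ∘ sym)) ⟩
      1# * x ⁻¹          ≈⟨ *-identityˡ _ ⟩
      x ⁻¹               ∎

  -- √ x is the supremum of the y with y ² ≤ x.  The alternative y ≈ 0# is
  -- redundant for 0# ≤ x; it makes the function total, with √ x ≈ 0# for x < 0#.
  Root : Carrier → Carrier → Set
  Root x y = y ² ≤ x ⊎ y ≈ 0#

  Root-bounded : ∀ x → ∃ (IsUpperBound (Root x))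
  Root-bounded x with total 1# x
  ... | inj₁ 1≤x = x , bound ≤-refl 1≤x
    where
    bound : ∀ {b} → x ≤ b → 1# ≤ b → IsUpperBound (Root x) b
    bound x≤b 1≤b y (inj₂ y≈0) = ≤-trans (≤-reflexive y≈0) (≤-trans 0≤1 1≤b)
    bound x≤b 1≤b y (inj₁ y²≤x) with total y 1#
    ... | inj₁ y≤1 = ≤-trans y≤1 1≤b
    ... | inj₂ 1≤y = begin
      y       ≈⟨ *-identityʳ y ⟨
      y * 1#  ≤⟨ *-monoˡ-≤ (≤-trans 0≤1 1≤y) 1≤y ⟩
      y ²     ≤⟨ y²≤x ⟩
      x       ≤⟨ x≤b ⟩
      _       ∎
  ... | inj₂ x≤1 = 1# , bound
    where
    bound : IsUpperBound (Root x) 1#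
    bound y (inj₂ y≈0) = ≤-trans (≤-reflexive y≈0) 0≤1
    bound y (inj₁ y²≤x) with total y 1#
    ... | inj₁ y≤1 = y≤1
    ... | inj₂ 1≤y = begin
      y       ≈⟨ *-identityʳ y ⟨
      y * 1#  ≤⟨ *-monoˡ-≤ (≤-trans 0≤1 1≤y) 1≤y ⟩
      y ²     ≤⟨ y²≤x ⟩
      x       ≤⟨ x≤1 ⟩
      1#      ∎

  √ : Carrier → Carrier
  √ x = proj₁ (supremum (Root x) (0# , inj₂ refl) (Root-bounded x))

  √-isSupremum : ∀ x → IsSupremum (Root x) (√ x)
  √-isSupremum x = proj₂ (supremum (Root x) (0# , inj₂ refl) (Root-bounded x))

  √-mono : ∀ {x y} → x ≤ y → √ x ≤ √ y
  √-mono {x} {y} x≤y = proj₂ (√-isSupremum x) (√ y) λ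
    { z (inj₁ z²≤x) → proj₁ (√-isSupremum y) z (inj₁ (≤-trans z²≤x x≤y))
    ; z (inj₂ z≈0)  → proj₁ (√-isSupremum y) z (inj₂ z≈0) }

  φ : Carrier → Carrier
  φ x = (1# + 1#) * √ x * (1# + x) ⁻¹

record FiniteSet : Set₁ where
  field
    Carrier : Set
    size    : ℕ
    enum    : Fin size ↔ Carrier

  at : Fin size → Carrier
  at = Inverse.to enum

  index : Carrier → Fin size
  index = Inverse.from enum

  at-index : ∀ a → at (index a) ≡ a
  at-index = Inverse.strictlyInverseˡ enum

  _≟_ : (a b : Carrier) → Dec (a ≡ b)
  _≟_ = Fin.inj⇒≟ (Inverse⇒Injection (↔-sym enum))

open FiniteSet using () renaming (Carrier to ∣_∣)

infixr 2 _×ᶠ_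
_×ᶠ_ : FiniteSet → FiniteSet → FiniteSet
A ×ᶠ B = record
  { Carrier = ∣ A ∣ × ∣ B ∣
  ; size    = FiniteSet.size A *ℕ FiniteSet.size B
  ; enum    = (FiniteSet.enum A ×-↔ FiniteSet.enum B) ↔-∘ Fin.*↔×
  }

module Games (ℝ : CompleteOrderedField) where

  open CompleteOrderedField ℝ renaming (Carrier to R; _≟_ to _≈?_)

  ∑ : (A : FiniteSet) → (∣ A ∣ → R) → R
  ∑ A f = sum (f ∘ FiniteSet.at A)

  infix 5 _when_
  _when_ : ∀ {P : Set} → R → Dec P → R
  x when P? = if does P? then x else 0#

  ∑-where : (A : FiniteSet) {P : ∣ A ∣ → Set} → (∀ a → Dec (P a)) → (∣ A ∣ → R) → R
  ∑-where A P? f = ∑ A λ a → f a when P? a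

  record ProjectionGame : Set₁ where
    field
      U V Alphabet Edge : FiniteSet
      src               : ∣ Edge ∣ → ∣ U ∣
      tgt               : ∣ Edge ∣ → ∣ V ∣
      weight            : ∣ Edge ∣ → R
      weight-nonneg     : ∀ e → 0# ≤ weight e
      constraint        : ∣ Edge ∣ → Rel ∣ Alphabet ∣ 0ℓ
      constraint?       : ∀ e → Decidable (constraint e)
      projection        : ∀ e {α α′ β} → constraint e α β → constraint e α′ β → α ≡ α′
      -- The alphabet is nonempty; otherwise there would be no assignments.
      letter            : ∣ Alphabet ∣

    total-weight : R
    total-weight = ∑ Edge weight

    Pr : ∣ Edge ∣ → R
    Pr e = weight e * total-weight ⁻¹

    μU : ∣ U ∣ → R
    μU u = ∑-where Edge (λ e → FiniteSet._≟_ U (src e) u) Pr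

    μV : ∣ V ∣ → R
    μV v = ∑-where Edge (λ e → FiniteSet._≟_ V (tgt e) v) Pr

    field
      total-weight-pos : 0# < total-weight
      μU-pos           : ∀ u → 0# < μU u
      μV-pos           : ∀ v → 0# < μV v

    operator : (∣ V ∣ → ∣ Alphabet ∣ → R) → (∣ U ∣ → ∣ Alphabet ∣ → R)
    operator f u α =
      ∑-where Edge (λ e → FiniteSet._≟_ U (src e) u) λ e →
        Pr e * μU u ⁻¹ * ∑-where Alphabet (constraint? e α) (f (tgt e))

    norm² : (∣ U ∣ → ∣ Alphabet ∣ → R) → R
    norm² g = ∑ U λ u → μU u * ∑ Alphabet λ α → g u α ²

    norm : (∣ U ∣ → ∣ Alphabet ∣ → R) → R
    norm g = √ (norm² g)

    record IsAssignment (f : ∣ V ∣ → ∣ Alphabet ∣ → R) : Set where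
      field
        nonneg     : ∀ v β → 0# ≤ f v β
        normalised : ∀ v → ∑ Alphabet (f v) ≈ 1#

    IsMaximum : R → Set
    IsMaximum m = (∃[ f ] (IsAssignment f × norm (operator f) ≈ m))
                × (∀ f → IsAssignment f → norm (operator f) ≤ m)

  private
    poset : Poset 0ℓ 0ℓ 0ℓ
    poset = record { isPartialOrder = isPartialOrder }

    open ≤-Reasoning poset
    open SemiringSum semiring using (sum-cong-≋; ∑-distrib-+; ∑-comm; *-distribˡ-sum; *-distribʳ-sum)
    open SemiringSolver commutativeSemiring using (solve; _:=_; _:+_; _:*_)

  when-cong : ∀ {P : Set} (P? : Dec P) {x y} → x ≈ y → (x when P?) ≈ (y when P?)
  when-cong (yes _) x≈y = x≈y
  when-cong (no _)  _   = refl

  when-yes : ∀ {P : Set} (P? : Dec P) {x} → P → (x when P?) ≈ x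
  when-yes (yes _) _ = refl
  when-yes (no ¬p) p = contradiction p ¬p

  when-no : ∀ {P : Set} (P? : Dec P) {x} → ¬ P → (x when P?) ≈ 0#
  when-no (yes p) ¬p = contradiction p ¬p
  when-no (no _)  _  = refl

  when-nonneg : ∀ {P : Set} (P? : Dec P) {x} → 0# ≤ x → 0# ≤ (x when P?)
  when-nonneg (yes _) 0≤x = 0≤x
  when-nonneg (no _)  _   = ≤-refl

  when-pos⁺ : ∀ {P : Set} (P? : Dec P) {x} → P → 0# < x → 0# < (x when P?)
  when-pos⁺ (yes _) _ 0<x = 0<x
  when-pos⁺ (no ¬p) p _   = contradiction p ¬p

  when-pos⁻ : ∀ {P : Set} (P? : Dec P) {x} → 0# < (x when P?) → P × 0# < x
  when-pos⁻ (yes p) 0<x = p , 0<x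
  when-pos⁻ (no _)  0<0 = contradiction refl (proj₂ 0<0)

  sum-mono : ∀ {n} {f g : Fin n → R} → (∀ i → f i ≤ g i) → sum f ≤ sum g
  sum-mono {zero}  f≤g = ≤-refl
  sum-mono {suc n} f≤g = +-mono-≤ (f≤g zero) (sum-mono (f≤g ∘ suc))

  sum-nonneg : ∀ {n} {f : Fin n → R} → (∀ i → 0# ≤ f i) → 0# ≤ sum f
  sum-nonneg {zero}  0≤f = ≤-refl
  sum-nonneg {suc n} 0≤f = +-nonneg (0≤f zero) (sum-nonneg (0≤f ∘ suc))

  sum-pos⁺ : ∀ {n} {f : Fin n → R} → (∀ i → 0# ≤ f i) → ∀ i → 0# < f i → 0# < sum f
  sum-pos⁺ {suc n} {f} 0≤f zero 0<f₀ = pos-respʳ-≤ 0<f₀ (begin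
    f zero       ≈⟨ +-identityʳ _ ⟨
    f zero + 0#  ≤⟨ +-monoʳ-≤ _ (sum-nonneg (0≤f ∘ suc)) ⟩
    sum f        ∎)
  sum-pos⁺ {suc n} {f} 0≤f (suc i) 0<fᵢ = pos-respʳ-≤ (sum-pos⁺ (0≤f ∘ suc) i 0<fᵢ) (begin
    sum (f ∘ suc)       ≈⟨ +-identityˡ _ ⟨
    0# + sum (f ∘ suc)  ≤⟨ +-monoˡ-≤ _ (0≤f zero) ⟩
    sum f               ∎)

  sum-pos⁻ : ∀ {n} {f : Fin n → R} → (∀ i → 0# ≤ f i) → 0# < sum f → ∃[ i ] 0# < f i
  sum-pos⁻ {zero}      0≤f 0<∑ = contradiction refl (proj₂ 0<∑)
  sum-pos⁻ {suc n} {f} 0≤f 0<∑ with 0# ≈? f zero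
  ... | no  0≉f₀ = zero , 0≤f zero , 0≉f₀
  ... | yes 0≈f₀ with sum-pos⁻ (0≤f ∘ suc) (pos-respʳ-≤ 0<∑ (≤-reflexive
                        (trans (+-congʳ (sym 0≈f₀)) (+-identityˡ _))))
  ...   | i , 0<fᵢ = suc i , 0<fᵢ

  module _ (A : FiniteSet) where
    open FiniteSet A using (at; index; at-index)

    ∑-cong : ∀ f g → (∀ a → f a ≈ g a) → ∑ A f ≈ ∑ A g
    ∑-cong f g f≈g = sum-cong-≋ (f≈g ∘ at)

    ∑-mono : ∀ f g → (∀ a → f a ≤ g a) → ∑ A f ≤ ∑ A g
    ∑-mono f g f≤g = sum-mono (f≤g ∘ at)

    ∑-distrib-* : ∀ k f → k * ∑ A f ≈ ∑ A (λ a → k * f a)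
    ∑-distrib-* k f = *-distribˡ-sum k (f ∘ at)

    ∑-distrib-*ʳ : ∀ k f → ∑ A f * k ≈ ∑ A (λ a → f a * k)
    ∑-distrib-*ʳ k f = *-distribʳ-sum k (f ∘ at)

    ∑-distrib : ∀ f g → ∑ A (λ a → f a + g a) ≈ ∑ A f + ∑ A g
    ∑-distrib f g = ∑-distrib-+ (f ∘ at) (g ∘ at)

    ∑-swap : ∀ B (f : ∣ A ∣ → ∣ B ∣ → R) → (∑ A λ a → ∑ B λ b → f a b) ≈ (∑ B λ b → ∑ A λ a → f a b)
    ∑-swap B f = ∑-comm (λ i j → f (at i) (FiniteSet.at B j))

    ∑-pos⁺ : ∀ {f} → (∀ a → 0# ≤ f a) → ∀ a → 0# < f a → 0# < ∑ A f
    ∑-pos⁺ {f} 0≤f a 0<fa =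
      sum-pos⁺ (0≤f ∘ at) (index a) (≡.subst (λ b → 0# < f b) (≡.sym (at-index a)) 0<fa)

    ∑-pos⁻ : ∀ {f} → (∀ a → 0# ≤ f a) → 0# < ∑ A f → ∃[ a ] 0# < f a
    ∑-pos⁻ 0≤f 0<∑ with sum-pos⁻ (0≤f ∘ at) 0<∑
    ... | i , 0<fᵢ = at i , 0<fᵢ

  module Positivity (G : ProjectionGame) where
    open ProjectionGame G

    Pr-nonneg : ∀ e → 0# ≤ Pr e
    Pr-nonneg e = *-nonneg (weight-nonneg e) (proj₁ (⁻¹-pos total-weight-pos))

    weight-pos : ∀ {e} → 0# < Pr e → 0# < weight e
    weight-pos {e} (_ , 0≉Pr) = weight-nonneg e , λ 0≈w →
      0≉Pr (trans (sym (zeroˡ _)) (*-congʳ 0≈w))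

    edge-at-u : ∀ u → ∃[ e ] (src e ≡ u × 0# < weight e)
    edge-at-u u with ∑-pos⁻ Edge (λ e → when-nonneg (FiniteSet._≟_ U (src e) u) (Pr-nonneg e)) (μU-pos u)
    ... | e , 0<x with when-pos⁻ (FiniteSet._≟_ U (src e) u) 0<x
    ...   | p , 0<Pr = e , p , weight-pos 0<Pr

    edge-at-v : ∀ v → ∃[ e ] (tgt e ≡ v × 0# < weight e)
    edge-at-v v with ∑-pos⁻ Edge (λ e → when-nonneg (FiniteSet._≟_ V (tgt e) v) (Pr-nonneg e)) (μV-pos v)
    ... | e , 0<x with when-pos⁻ (FiniteSet._≟_ V (tgt e) v) 0<x
    ...   | p , 0<Pr = e , p , weight-pos 0<Pr

  infixr 7 _⊗_
  _⊗_ : ProjectionGame → ProjectionGame → ProjectionGame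
  G ⊗ H = record
    { U                = G.U ×ᶠ H.U
    ; V                = G.V ×ᶠ H.V
    ; Alphabet         = G.Alphabet ×ᶠ H.Alphabet
    ; Edge             = E
    ; src              = λ (e , e′) → G.src e , H.src e′
    ; tgt              = λ (e , e′) → G.tgt e , H.tgt e′
    ; weight           = w
    ; weight-nonneg    = w-nonneg
    ; constraint       = λ (e , e′) (α , α′) (β , β′) → G.constraint e α β × H.constraint e′ α′ β′
    ; constraint?      = λ (e , e′) (α , α′) (β , β′) → G.constraint? e α β ×-dec H.constraint? e′ α′ β′
    ; projection       = λ (e , e′) (p , p′) (q , q′) → ≡.cong₂ _,_ (G.projection e p q) (H.projection e′ p′ q′)
    ; letter           = G.letter , H.letter
    ; total-weight-pos = W-pos
    ; μU-pos           = μU-pos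
    ; μV-pos           = μV-pos
    }
    where
    module G = ProjectionGame G
    module H = ProjectionGame H
    module G⁺ = Positivity G
    module H⁺ = Positivity H

    E : FiniteSet
    E = G.Edge ×ᶠ H.Edge

    w : ∣ E ∣ → R
    w (e , e′) = G.weight e * H.weight e′

    w-nonneg : ∀ e → 0# ≤ w e
    w-nonneg (e , e′) = *-nonneg (G.weight-nonneg e) (H.weight-nonneg e′)

    W-pos : 0# < ∑ E w
    W-pos with ∑-pos⁻ G.Edge G.weight-nonneg G.total-weight-pos
             | ∑-pos⁻ H.Edge H.weight-nonneg H.total-weight-pos
    ... | e , 0<w | e′ , 0<w′ = ∑-pos⁺ E w-nonneg (e , e′) (*-pos 0<w 0<w′)

    pr : ∣ E ∣ → R
    pr e = w e * (∑ E w) ⁻¹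

    pr-nonneg : ∀ e → 0# ≤ pr e
    pr-nonneg e = *-nonneg (w-nonneg e) (proj₁ (⁻¹-pos W-pos))

    module UU = FiniteSet (G.U ×ᶠ H.U)
    module VV = FiniteSet (G.V ×ᶠ H.V)

    μU-pos : ∀ u → 0# < ∑-where E (λ e → (G.src (proj₁ e) , H.src (proj₂ e)) UU.≟ u) pr
    μU-pos (u , u′) with G⁺.edge-at-u u | H⁺.edge-at-u u′
    ... | e , p , 0<w | e′ , p′ , 0<w′ =
      ∑-pos⁺ E (λ d → when-nonneg (_ UU.≟ _) (pr-nonneg d)) (e , e′)
        (when-pos⁺ (_ UU.≟ _) (≡.cong₂ _,_ p p′) (*-pos (*-pos 0<w 0<w′) (⁻¹-pos W-pos)))

    μV-pos : ∀ v → 0# < ∑-where E (λ e → (G.tgt (proj₁ e) , H.tgt (proj₂ e)) VV.≟ v) pr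
    μV-pos (v , v′) with G⁺.edge-at-v v | H⁺.edge-at-v v′
    ... | e , p , 0<w | e′ , p′ , 0<w′ =
      ∑-pos⁺ E (λ d → when-nonneg (_ VV.≟ _) (pr-nonneg d)) (e , e′)
        (when-pos⁺ (_ VV.≟ _) (≡.cong₂ _,_ p p′) (*-pos (*-pos 0<w 0<w′) (⁻¹-pos W-pos)))

  sum-single : ∀ {n} (f : Fin n → R) i → (∀ j → ¬ i ≡ j → f j ≈ 0#) → sum f ≈ f i
  sum-single {suc n} f zero f≈0 = trans (+-congˡ (sum-zero λ i → f≈0 (suc i) λ ())) (+-identityʳ _)
    where
    sum-zero : ∀ {n} {g : Fin n → R} → (∀ i → g i ≈ 0#) → sum g ≈ 0#
    sum-zero {zero}  g≈0 = refl
    sum-zero {suc n} g≈0 = trans (+-cong (g≈0 zero) (sum-zero (g≈0 ∘ suc))) (+-identityˡ 0#)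
  sum-single {suc n} f (suc i) f≈0 =
    trans (+-cong (f≈0 zero λ ()) (sum-single (f ∘ suc) i λ j i≢j → f≈0 (suc j) (i≢j ∘ Fin.suc-injective)))
          (+-identityˡ _)

  argmax-Fin : ∀ {n} (f : Fin (suc n) → R) → ∃[ i ] (∀ j → f j ≤ f i)
  argmax-Fin {zero} f = zero , λ { zero → ≤-refl }
  argmax-Fin {suc n} f with argmax-Fin (f ∘ suc)
  ... | i , f≤fᵢ with total (f zero) (f (suc i))
  ...   | inj₁ f₀≤fᵢ = suc i , λ { zero → f₀≤fᵢ ; (suc j) → f≤fᵢ j }
  ...   | inj₂ fᵢ≤f₀ = zero  , λ { zero → ≤-refl ; (suc j) → ≤-trans (f≤fᵢ j) fᵢ≤f₀ }

  module _ (A : FiniteSet) where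
    open FiniteSet A using (at; index; at-index; _≟_)

    ∑-delta : ∀ a (f : ∣ A ∣ → R) → ∑ A (λ b → f b * (1# when a ≟ b)) ≈ f a
    ∑-delta a f = begin-equality
      ∑ A (λ b → f b * (1# when a ≟ b))                    ≈⟨ sum-single _ (index a) off ⟩
      f (at (index a)) * (1# when a ≟ at (index a))        ≈⟨ on (at-index a) ⟩
      f a                                                  ∎
      where
      on : ∀ {b} → b ≡ a → f b * (1# when a ≟ b) ≈ f a
      on ≡.refl = trans (*-congˡ (when-yes (a ≟ a) ≡.refl)) (*-identityʳ _)
      off : ∀ j → ¬ index a ≡ j → f (at j) * (1# when a ≟ at j) ≈ 0#
      off j i≢j = trans (*-congˡ (when-no (a ≟ at j) λ a≡aⱼ →
        i≢j (≡.trans (≡.cong index a≡aⱼ) (Inverse.strictlyInverseʳ (FiniteSet.enum A) j)))) (zeroʳ _)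

    argmax : ∣ A ∣ → (f : ∣ A ∣ → R) → ∃[ a ] (∀ b → f b ≤ f a)
    argmax a₀ f with FiniteSet.size A | FiniteSet.enum A
    ... | zero  | e with Inverse.from e a₀
    ...   | ()
    argmax a₀ f | suc n | e with argmax-Fin (f ∘ Inverse.to e)
    ...   | i , f≤fᵢ = Inverse.to e i , λ b →
            ≡.subst (λ c → f c ≤ f (Inverse.to e i)) (Inverse.strictlyInverseˡ e b) (f≤fᵢ (Inverse.from e b))

    argmax-word : ∣ A ∣ → ∀ {n} (F : (Fin n → ∣ A ∣) → R) → (∀ {b b′} → b ≗ b′ → F b ≈ F b′) →
                  ∃[ b ] (∀ b′ → F b′ ≤ F b)
    argmax-word a₀ {zero} F F-cong = (λ ()) , λ b′ → ≤-reflexive (F-cong λ ())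
    argmax-word a₀ {suc n} F F-cong
      with (λ a → argmax-word a₀ (λ b → F (cons a b)) λ b≗b′ → F-cong λ { zero → ≡.refl ; (suc i) → b≗b′ i })
    ... | rest with argmax a₀ (λ a → F (cons a (proj₁ (rest a))))
    ...   | a , F≤ = cons a (proj₁ (rest a)) , λ b′ → begin
              F b′                                          ≈⟨ F-cong (λ { zero → ≡.refl ; (suc i) → ≡.refl }) ⟩
              F (cons (b′ zero) (b′ ∘ suc))                 ≤⟨ proj₂ (rest (b′ zero)) (b′ ∘ suc) ⟩
              F (cons (b′ zero) (proj₁ (rest (b′ zero))))   ≤⟨ F≤ (b′ zero) ⟩
              F (cons a (proj₁ (rest a)))                   ∎

  argmax-map : ∀ (A B : FiniteSet) → ∣ B ∣ → (F : (∣ A ∣ → ∣ B ∣) → R) → (∀ {b b′} → b ≗ b′ → F b ≈ F b′) →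
               ∃[ b ] (∀ b′ → F b′ ≤ F b)
  argmax-map A B b₀ F F-cong
    with argmax-word B b₀ (λ w → F (w ∘ FiniteSet.index A)) (λ w≗w′ → F-cong (w≗w′ ∘ FiniteSet.index A))
  ... | w , F≤ = w ∘ FiniteSet.index A , λ b′ → ≤-trans
          (≤-reflexive (F-cong λ a → ≡.cong b′ (≡.sym (FiniteSet.at-index A a))))
          (F≤ (b′ ∘ FiniteSet.at A))

  -- The maximum defining the collision value exists: f ↦ ∥ G f ∥² is convex, so
  -- it is bounded at f by its value at some 0/1-valued assignment.
  module Maximum (G : ProjectionGame) where
    open ProjectionGame G

    Table : Set
    Table = ∣ V ∣ → ∣ Alphabet ∣ → R

    pairing : Table → Table → R
    pairing c f = ∑ V λ v → ∑ Alphabet λ β → c v β * f v β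

    ∑∑-cong : ∀ (x y : Table) → (∀ v β → x v β ≈ y v β) →
              (∑ V λ v → ∑ Alphabet (x v)) ≈ (∑ V λ v → ∑ Alphabet (y v))
    ∑∑-cong x y x≈y = ∑-cong V (λ v → ∑ Alphabet (x v)) (λ v → ∑ Alphabet (y v))
      λ v → ∑-cong Alphabet (x v) (y v) (x≈y v)

    IsLinear : (Table → R) → Set
    IsLinear F = ∃[ c ] (∀ f → F f ≈ pairing c f)

    linear-cong : ∀ {F F′} → (∀ f → F f ≈ F′ f) → IsLinear F′ → IsLinear F
    linear-cong F≈F′ (c , eq) = c , λ f → trans (F≈F′ f) (eq f)

    linear-scale : ∀ k {F} → IsLinear F → IsLinear (λ f → k * F f)
    linear-scale k {F} (c , eq) = (λ v β → k * c v β) , λ f → begin-equality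
      k * F f                                              ≈⟨ *-congˡ (eq f) ⟩
      k * pairing c f                                      ≈⟨ ∑-distrib-* V k (λ v → ∑ Alphabet λ β → c v β * f v β) ⟩
      (∑ V λ v → k * ∑ Alphabet λ β → c v β * f v β)
        ≈⟨ ∑-cong V (λ v → k * ∑ Alphabet λ β → c v β * f v β) (λ v → ∑ Alphabet λ β → k * (c v β * f v β))
             (λ v → ∑-distrib-* Alphabet k (λ β → c v β * f v β)) ⟩
      (∑ V λ v → ∑ Alphabet λ β → k * (c v β * f v β))
        ≈⟨ ∑∑-cong (λ v β → k * c v β * f v β) (λ v β → k * (c v β * f v β)) (λ v β → *-assoc k (c v β) (f v β)) ⟨
      pairing (λ v β → k * c v β) f                        ∎

    linear-when : ∀ {P : Set} (P? : Dec P) {F} → IsLinear F → IsLinear (λ f → F f when P?)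
    linear-when (yes _) F-lin = F-lin
    linear-when (no _) {F} F-lin = linear-cong (λ f → sym (zeroˡ (F f))) (linear-scale 0# F-lin)

    linear-∑ : ∀ A (F : ∣ A ∣ → Table → R) → (∀ a → IsLinear (F a)) → IsLinear (λ f → ∑ A λ a → F a f)
    linear-∑ A F F-lin = ∑c , λ f → begin-equality
      (∑ A λ a → F a f)
        ≈⟨ ∑-cong A (λ a → F a f) (λ a → pairing (c a) f) (λ a → proj₂ (F-lin a) f) ⟩
      (∑ A λ a → ∑ V λ v → ∑ Alphabet λ β → c a v β * f v β)
        ≈⟨ ∑-swap A V (λ a v → ∑ Alphabet λ β → c a v β * f v β) ⟩
      (∑ V λ v → ∑ A λ a → ∑ Alphabet λ β → c a v β * f v β)
        ≈⟨ ∑-cong V (λ v → ∑ A λ a → ∑ Alphabet λ β → c a v β * f v β)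
                    (λ v → ∑ Alphabet λ β → ∑ A λ a → c a v β * f v β)
                    (λ v → ∑-swap A Alphabet λ a β → c a v β * f v β) ⟩
      (∑ V λ v → ∑ Alphabet λ β → ∑ A λ a → c a v β * f v β)
        ≈⟨ ∑∑-cong (λ v β → ∑c v β * f v β) (λ v β → ∑ A λ a → c a v β * f v β)
             (λ v β → ∑-distrib-*ʳ A (f v β) (λ a → c a v β)) ⟨
      pairing ∑c f ∎
      where
      c : ∣ A ∣ → Table
      c a = proj₁ (F-lin a)
      ∑c : Table
      ∑c v β = ∑ A λ a → c a v β

    linear-eval : ∀ v β → IsLinear (λ f → f v β)
    linear-eval v β = (λ w γ → δᵥ w * δᵦ γ) , λ f → sym (begin-equality
      pairing (λ w γ → δᵥ w * δᵦ γ) f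
        ≈⟨ ∑∑-cong (λ w γ → δᵥ w * δᵦ γ * f w γ) (λ w γ → f w γ * δᵦ γ * δᵥ w)
             (λ w γ → solve 3 (λ x y z → (x :* y) :* z := (z :* y) :* x) refl (δᵥ w) (δᵦ γ) (f w γ)) ⟩
      (∑ V λ w → ∑ Alphabet λ γ → f w γ * δᵦ γ * δᵥ w)
        ≈⟨ ∑-cong V (λ w → (∑ Alphabet λ γ → f w γ * δᵦ γ) * δᵥ w) (λ w → ∑ Alphabet λ γ → f w γ * δᵦ γ * δᵥ w)
             (λ w → ∑-distrib-*ʳ Alphabet (δᵥ w) (λ γ → f w γ * δᵦ γ)) ⟨
      (∑ V λ w → (∑ Alphabet λ γ → f w γ * δᵦ γ) * δᵥ w)
        ≈⟨ ∑-cong V (λ w → (∑ Alphabet λ γ → f w γ * δᵦ γ) * δᵥ w) (λ w → f w β * δᵥ w)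
             (λ w → *-congʳ (∑-delta Alphabet β (f w))) ⟩
      (∑ V λ w → f w β * δᵥ w)
        ≈⟨ ∑-delta V v (λ w → f w β) ⟩
      f v β ∎)
      where
      δᵥ : ∣ V ∣ → R
      δᵥ w = 1# when FiniteSet._≟_ V v w
      δᵦ : ∣ Alphabet ∣ → R
      δᵦ γ = 1# when FiniteSet._≟_ Alphabet β γ

    linear-operator : ∀ u α → IsLinear (λ f → operator f u α)
    linear-operator u α = linear-∑ Edge _ λ e → linear-when (FiniteSet._≟_ U (src e) u)
      (linear-scale (Pr e * μU u ⁻¹) (linear-∑ Alphabet _ λ β → linear-when (constraint? e α β) (linear-eval (tgt e) β)))

    inner : (g h : ∣ U ∣ → ∣ Alphabet ∣ → R) → R
    inner g h = ∑ U λ u → μU u * ∑ Alphabet λ α → g u α * h u α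

    inner+inner≤norm²+norm² : ∀ g h → inner g h + inner g h ≤ norm² g + norm² h
    inner+inner≤norm²+norm² g h = ∑-double U (weighted gh) (weighted gg) (weighted hh) λ u → begin
      weighted gh u + weighted gh u                      ≈⟨ distribˡ _ _ _ ⟨
      μU u * (∑ Alphabet (gh u) + ∑ Alphabet (gh u))
        ≤⟨ *-monoˡ-≤ (proj₁ (μU-pos u)) (∑-double Alphabet (gh u) (gg u) (hh u) λ α → x*y+x*y≤x²+y² (g u α) (h u α)) ⟩
      μU u * (∑ Alphabet (gg u) + ∑ Alphabet (hh u))     ≈⟨ distribˡ _ _ _ ⟩
      weighted gg u + weighted hh u                      ∎
      where
      gh gg hh : ∣ U ∣ → ∣ Alphabet ∣ → R
      gh u α = g u α * h u α
      gg u α = g u α ²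
      hh u α = h u α ²
      weighted : (∣ U ∣ → ∣ Alphabet ∣ → R) → ∣ U ∣ → R
      weighted x u = μU u * ∑ Alphabet (x u)
      ∑-double : ∀ A (z x y : ∣ A ∣ → R) → (∀ a → z a + z a ≤ x a + y a) → ∑ A z + ∑ A z ≤ ∑ A x + ∑ A y
      ∑-double A z x y z≤ = begin
        ∑ A z + ∑ A z            ≈⟨ ∑-distrib A z z ⟨
        ∑ A (λ a → z a + z a)    ≤⟨ ∑-mono A (λ a → z a + z a) (λ a → x a + y a) z≤ ⟩
        ∑ A (λ a → x a + y a)    ≈⟨ ∑-distrib A x y ⟩
        ∑ A x + ∑ A y            ∎

    deterministic : (∣ V ∣ → ∣ Alphabet ∣) → Table
    deterministic b v β = 1# when FiniteSet._≟_ Alphabet (b v) β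

    deterministic-isAssignment : ∀ b → IsAssignment (deterministic b)
    deterministic-isAssignment b = record
      { nonneg     = λ v β → when-nonneg (FiniteSet._≟_ Alphabet (b v) β) 0≤1
      ; normalised = λ v → trans
          (∑-cong Alphabet (deterministic b v) (λ β → 1# * deterministic b v β) λ β → sym (*-identityˡ _))
          (∑-delta Alphabet (b v) (λ _ → 1#))
      }

    linear-rounding : ∀ {F} → IsLinear F → ∀ {f} → IsAssignment f → ∃[ b ] F f ≤ F (deterministic b)
    linear-rounding {F} (c , eq) {f} f-asg = b , (begin
      F f                          ≈⟨ eq f ⟩
      pairing c f                  ≤⟨ ∑-mono V (λ v → ∑ Alphabet λ β → c v β * f v β)
                                               (λ v → ∑ Alphabet λ β → c v β * deterministic b v β) row ⟩
      pairing c (deterministic b)  ≈⟨ eq _ ⟨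
      F (deterministic b)          ∎)
      where
      open IsAssignment f-asg
      best : ∀ v → ∃[ β ] (∀ γ → c v γ ≤ c v β)
      best v = argmax Alphabet letter (c v)
      b : ∣ V ∣ → ∣ Alphabet ∣
      b v = proj₁ (best v)
      row : ∀ v → (∑ Alphabet λ β → c v β * f v β) ≤ (∑ Alphabet λ β → c v β * deterministic b v β)
      row v = begin
        (∑ Alphabet λ β → c v β * f v β)
          ≤⟨ ∑-mono Alphabet (λ β → c v β * f v β) (λ β → f v β * c v (b v)) (λ β →
               ≤-trans (≤-reflexive (*-comm (c v β) (f v β))) (*-monoˡ-≤ (nonneg v β) (proj₂ (best v) β))) ⟩
        (∑ Alphabet λ β → f v β * c v (b v))  ≈⟨ ∑-distrib-*ʳ Alphabet (c v (b v)) (f v) ⟨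
        ∑ Alphabet (f v) * c v (b v)          ≈⟨ *-congʳ (normalised v) ⟩
        1# * c v (b v)                        ≈⟨ *-identityˡ _ ⟩
        c v (b v)                             ≈⟨ ∑-delta Alphabet (b v) (c v) ⟨
        (∑ Alphabet λ β → c v β * deterministic b v β) ∎

    rounding : ∀ {f} → IsAssignment f → ∃[ b ] norm² (operator f) ≤ norm² (operator (deterministic b))
    rounding {f} f-asg = proj₁ rounded , +-cancelʳ-≤ (norm² Gf) (begin
      norm² Gf + norm² Gf                  ≤⟨ +-mono-≤ (proj₂ rounded) (proj₂ rounded) ⟩
      inner Gf Gb + inner Gf Gb            ≤⟨ inner+inner≤norm²+norm² Gf Gb ⟩
      norm² Gf + norm² Gb                  ≈⟨ +-comm _ _ ⟩
      norm² Gb + norm² Gf                  ∎)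
      where
      Gf : ∣ U ∣ → ∣ Alphabet ∣ → R
      Gf = operator f
      rounded : ∃[ b ] inner Gf Gf ≤ inner Gf (operator (deterministic b))
      rounded = linear-rounding {λ h → inner Gf (operator h)}
        (linear-∑ U _ λ u → linear-scale (μU u) (linear-∑ Alphabet _ λ α → linear-scale (Gf u α) (linear-operator u α)))
        f-asg
      Gb : ∣ U ∣ → ∣ Alphabet ∣ → R
      Gb = operator (deterministic (proj₁ rounded))

    norm²-cong : ∀ f f′ → (∀ v β → f v β ≈ f′ v β) → norm² (operator f) ≈ norm² (operator f′)
    norm²-cong f f′ f≈f′ = ∑-cong U _ _ λ u → *-congˡ {μU u} (∑-cong Alphabet
      (λ α → operator f u α ²) (λ α → operator f′ u α ²) λ α → *-cong (operator-cong u α) (operator-cong u α))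
      where
      operator-cong : ∀ u α → operator f u α ≈ operator f′ u α
      operator-cong u α = ∑-cong Edge
        (λ e → term f e when FiniteSet._≟_ U (src e) u) (λ e → term f′ e when FiniteSet._≟_ U (src e) u)
        λ e → when-cong (FiniteSet._≟_ U (src e) u) (*-congˡ (∑-cong Alphabet
          (λ β → f (tgt e) β when constraint? e α β) (λ β → f′ (tgt e) β when constraint? e α β)
          λ β → when-cong (constraint? e α β) (f≈f′ (tgt e) β)))
        where
        term : Table → ∣ Edge ∣ → R
        term h e = Pr e * μU u ⁻¹ * ∑-where Alphabet (constraint? e α) (h (tgt e))

    abstract
      maximum-exists : ∃ IsMaximum
      maximum-exists = norm (operator (deterministic (proj₁ best)))
                     , (deterministic (proj₁ best) , deterministic-isAssignment (proj₁ best) , refl)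
                     , λ f f-asg → let b , f≤b = rounding f-asg in √-mono (≤-trans f≤b (proj₂ best b))
        where
        best : ∃[ b ] (∀ b′ → norm² (operator (deterministic b′)) ≤ norm² (operator (deterministic b)))
        best = argmax-map V Alphabet letter (λ b → norm² (operator (deterministic b))) λ {b} {b′} b≗b′ →
          norm²-cong (deterministic b) (deterministic b′) λ v β →
            ≡.subst (λ γ → deterministic b v β ≈ (1# when FiniteSet._≟_ Alphabet γ β)) (b≗b′ v) refl

  ‖_‖ : ProjectionGame → R
  ‖ G ‖ = proj₁ (Maximum.maximum-exists G)

  ‖‖-isMaximum : ∀ G → ProjectionGame.IsMaximum G ‖ G ‖
  ‖‖-isMaximum G = proj₂ (Maximum.maximum-exists G)

module Submission where

open import Defs
open import Data.Bool.Base using (Bool; true; false; not; _∧_; _∨_; if_then_else_)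
open import Data.Bool.Properties using (∧-comm; ∨-comm)
open import Data.Fin.Base using (Fin; zero; suc; punchIn; punchOut)
import Data.Fin.Properties as Fin
open import Data.Nat.Base using (ℕ; zero; suc)
open import Data.Product.Base using (∃-syntax; _×_; _,_; proj₁; proj₂)
open import Data.Sum.Base using (_⊎_; inj₁; inj₂)
open import Data.Vec.Functional using (removeAt) renaming (_∷_ to cons)
open import Function.Base using (_∘_)
open import Function.Bundles using (Injection)
open import Function.Properties.Inverse using (Inverse⇒Injection; ↔-refl)
open import Level using (0ℓ)
open import Relation.Binary.Bundles using (Poset)
open import Relation.Binary.PropositionalEquality.Core as ≡ using (_≡_)
open import Relation.Nullary using (¬_; Dec; yes; no; does; contradiction)
open import Relation.Nullary.Decidable using (_×-dec_)
import Algebra.Properties.Semiring.Sum as SemiringSum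
import Algebra.Solver.Ring.NaturalCoefficients.Default as SemiringSolver
import Relation.Binary.Reasoning.PartialOrder as PosetReasoning
open FiniteSet using () renaming (Carrier to ∣_∣)

-- For an optimal assignment f of G ⊗ H put h = (Id ⊗ H) f, a family of
-- nonnegative functions h ω on V × Σ indexed by the questions and answers ω of H.
-- Its masses k ω v = ∑_β h ω (v , β) satisfy 𝔼 (k ω v)² ≤ N = ∥ H ∥² for every v,
-- because ∑_β f is an assignment of H, and ∥ (G ⊗ H) f ∥² = 𝔼 ∥ G (h ω) ∥².
-- So it suffices to show that 𝔼 ∥ G (h ω) ∥² ≤ φ(∥ G ∥²) N for such families.
--
-- Rounding: choosing ω and a threshold for (k ω v)² gives weighted partial
-- assignments in which any v and v′ are both covered with weight
-- ∑ min((k ω v)², (k ω v′)²).  Draw these in random order and let every vertex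
-- follow the first one covering it.  Two vertices then agree with probability
-- y ≥ m / (2N - m), where m is the weight on which both are covered and agree,
-- whereas their contribution x to 𝔼 ∥ G (h ω) ∥² satisfies x² ≤ m (2N - m) since
-- k k′ is the geometric mean of the minimum and the maximum of k² and k′².
-- Averaging over pairs of edges at a common vertex of U, with 𝔼 y ≤ ∥ G ∥² as
-- every outcome is an assignment, gives the bound by convexity.

module CollisionValue (ℝ : CompleteOrderedField) where
  open CompleteOrderedField ℝ renaming (Carrier to R; _≟_ to _≈?_)
  open Games ℝ

  poset : Poset 0ℓ 0ℓ 0ℓ
  poset = record { isPartialOrder = isPartialOrder }

  open PosetReasoning poset
  open SemiringSum semiring
    using (sum-cong-≋; sum-remove; sum-replicate-zero; ∑-distrib-+; ∑-comm; *-distribˡ-sum; *-distribʳ-sum)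
  open SemiringSolver commutativeSemiring using (solve; con; _:=_; _:+_; _:*_)

  -- Ordered fields and square roots

  ≰⇒> : ∀ {x y} → ¬ x ≤ y → y < x
  ≰⇒> {x} {y} x≰y with total x y
  ... | inj₁ x≤y = contradiction x≤y x≰y
  ... | inj₂ y≤x = y≤x , λ y≈x → x≰y (≤-reflexive (sym y≈x))

  <⇒≱ : ∀ {x y} → x < y → ¬ y ≤ x
  <⇒≱ (x≤y , x≉y) y≤x = x≉y (antisym x≤y y≤x)

  *-monoʳ-≤ : ∀ {z x y} → 0# ≤ z → x ≤ y → x * z ≤ y * z
  *-monoʳ-≤ {z} {x} {y} 0≤z x≤y = begin
    x * z  ≈⟨ *-comm x z ⟩
    z * x  ≤⟨ *-monoˡ-≤ 0≤z x≤y ⟩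
    z * y  ≈⟨ *-comm z y ⟩
    y * z  ∎

  *-cancelʳ-≤ : ∀ {z x y} → 0# < z → x * z ≤ y * z → x ≤ y
  *-cancelʳ-≤ {z} {x} {y} 0<z xz≤yz = begin
    x              ≈⟨ cancel x ⟨
    x * z * z ⁻¹   ≤⟨ *-monoʳ-≤ (proj₁ (⁻¹-pos 0<z)) xz≤yz ⟩
    y * z * z ⁻¹   ≈⟨ cancel y ⟩
    y              ∎
    where
    cancel : ∀ w → w * z * z ⁻¹ ≈ w
    cancel w = trans (*-assoc w z (z ⁻¹))
      (trans (*-congˡ (*-inverseʳ z λ z≈0 → proj₂ 0<z (sym z≈0))) (*-identityʳ w))

  -- In the case `y < x`, where `x` is positive because `0# ≤ y`, cancelling `x` in
  -- `x * x ≤ y ² ≤ y * x` still yields `x ≤ y`.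
  ²-cancel-≤ : ∀ {x y} → 0# ≤ y → x ² ≤ y ² → x ≤ y
  ²-cancel-≤ {x} {y} 0≤y x²≤y² with x ≤? y
  ... | yes x≤y = x≤y
  ... | no  x≰y = *-cancelʳ-≤ 0<x (≤-trans x²≤y² (*-monoˡ-≤ 0≤y (proj₁ y<x)))
    where
    y<x : y < x
    y<x = ≰⇒> x≰y
    0<x : 0# < x
    0<x = ≤-trans 0≤y (proj₁ y<x) , λ 0≈x → x≰y (≤-trans (≤-reflexive (sym 0≈x)) 0≤y)

  -- Compare squares: four times `c ²` is at most four times `a * b`, hence at most `(a + b) ²`.
  -- Taking any `c` with `c ² ≤ a * b` in place of a geometric mean keeps square roots out of all
  -- applications.
  am-gm : ∀ {a b c} → 0# ≤ a → 0# ≤ b → c ² ≤ a * b → c + c ≤ a + b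
  am-gm {a} {b} {c} 0≤a 0≤b c²≤ab = ²-cancel-≤ (+-nonneg 0≤a 0≤b) (begin
    (c + c) ²
      ≈⟨ solve 1 (λ c → (c :+ c) :* (c :+ c) := (c :* c :+ c :* c) :+ (c :* c :+ c :* c)) refl c ⟩
    (c ² + c ²) + (c ² + c ²)          ≤⟨ +-mono-≤ (+-mono-≤ c²≤ab c²≤ab) (+-mono-≤ c²≤ab c²≤ab) ⟩
    (a * b + a * b) + (a * b + a * b)  ≤⟨ +-monoˡ-≤ _ (x*y+x*y≤x²+y² a b) ⟩
    (a ² + b ²) + (a * b + a * b)
      ≈⟨ solve 2 (λ a b → (a :* a :+ b :* b) :+ (a :* b :+ a :* b) := (a :+ b) :* (a :+ b)) refl a b ⟩
    (a + b) ²                          ∎)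

  +-pos : ∀ {x y} → 0# < x → 0# ≤ y → 0# < x + y
  +-pos {x} {y} 0<x 0≤y = pos-respʳ-≤ 0<x (≤-trans (≤-reflexive (sym (+-identityʳ x))) (+-monoʳ-≤ x 0≤y))

  0<1 : 0# < 1#
  0<1 = 0≤1 , λ 0≈1 → 1≉0 (sym 0≈1)

  √-nonneg : ∀ x → 0# ≤ √ x
  √-nonneg x = proj₁ (√-isSupremum x) 0# (inj₂ refl)

  -- If √ x ² + δ ≈ x with 0# < δ, then √ x + ε with ε = δ / (2 √ x + 1 + δ) is
  -- still a root; if x < √ x ², then (√ x ² + x) / (2 √ x) is a smaller bound.
  √-square : ∀ {x} → 0# ≤ x → √ x ² ≈ x
  √-square {x} 0≤x = antisym s²≤x x≤s²
    where
    s : R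
    s = √ x
    0≤s : 0# ≤ s
    0≤s = √-nonneg x

    x≤s² : x ≤ s ²
    x≤s² with x ≤? s ²
    ... | yes x≤s² = x≤s²
    ... | no  x≰s² with ≤⇒difference (proj₁ (≰⇒> x≰s²))
    ...   | δ , 0≤δ , x≈s²+δ = contradiction s+ε≤s (<⇒≱ s<s+ε)
      where
      0<δ : 0# < δ
      0<δ = 0≤δ , λ 0≈δ → x≰s² (≤-reflexive (trans x≈s²+δ (trans (+-congˡ (sym 0≈δ)) (+-identityʳ _))))
      -- The summand `δ` forces `ε ≤ 1#`, and the summand `1#` pays for the quadratic term through
      -- `ε * ε ≤ ε * 1#`.
      D : R
      D = 1# + (s + s + δ)
      0<D : 0# < D
      0<D = +-pos 0<1 (+-nonneg (+-nonneg 0≤s 0≤s) 0≤δ)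
      ε : R
      ε = δ * D ⁻¹
      0<ε : 0# < ε
      0<ε = *-pos 0<δ (⁻¹-pos 0<D)
      εD≈δ : ε * D ≈ δ
      εD≈δ = trans (*-assoc δ (D ⁻¹) D) (trans (*-congˡ (trans (*-comm (D ⁻¹) D)
               (*-inverseʳ D λ D≈0 → proj₂ 0<D (sym D≈0)))) (*-identityʳ δ))
      ε≤1 : ε ≤ 1#
      ε≤1 = *-cancelʳ-≤ 0<D (begin
        ε * D            ≈⟨ εD≈δ ⟩
        δ                ≈⟨ +-identityˡ δ ⟨
        0# + δ           ≤⟨ +-monoˡ-≤ δ (+-nonneg 0≤1 (+-nonneg 0≤s 0≤s)) ⟩
        1# + (s + s) + δ ≈⟨ +-assoc 1# (s + s) δ ⟩
        D                ≈⟨ *-identityˡ D ⟨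
        1# * D           ∎)
      s+ε≤s : s + ε ≤ s
      s+ε≤s = proj₁ (√-isSupremum x) (s + ε) (inj₁ (begin
        (s + ε) ²
          ≈⟨ solve 2 (λ s ε → (s :+ ε) :* (s :+ ε) := s :* s :+ (ε :* (s :+ s) :+ ε :* ε)) refl s ε ⟩
        s ² + (ε * (s + s) + ε * ε)      ≤⟨ +-monoʳ-≤ _ (+-monoʳ-≤ _ (*-monoˡ-≤ (proj₁ 0<ε) ε≤1)) ⟩
        s ² + (ε * (s + s) + ε * 1#)     ≈⟨ +-identityʳ _ ⟨
        s ² + (ε * (s + s) + ε * 1#) + 0# ≤⟨ +-monoʳ-≤ _ (*-nonneg (proj₁ 0<ε) 0≤δ) ⟩
        s ² + (ε * (s + s) + ε * 1#) + ε * δ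
          ≈⟨ solve 4 (λ s ε o δ → s :* s :+ (ε :* (s :+ s) :+ ε :* o) :+ ε :* δ
               := s :* s :+ ε :* (o :+ (s :+ s :+ δ))) refl s ε 1# δ ⟩
        s ² + ε * D                      ≈⟨ +-congˡ εD≈δ ⟩
        s ² + δ                          ≈⟨ x≈s²+δ ⟨
        x                                ∎))
      s<s+ε : s < s + ε
      s<s+ε = (begin
        s       ≈⟨ +-identityʳ s ⟨
        s + 0#  ≤⟨ +-monoʳ-≤ s (proj₁ 0<ε) ⟩
        s + ε   ∎) , λ s≈s+ε → <⇒≱ 0<ε (+-cancelʳ-≤ s (begin
        ε + s   ≈⟨ +-comm ε s ⟩
        s + ε   ≈⟨ s≈s+ε ⟨
        s       ≈⟨ +-identityˡ s ⟨
        0# + s  ∎))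

    s²≤x : s ² ≤ x
    s²≤x with s ² ≤? x
    ... | yes s²≤x = s²≤x
    ... | no  s²≰x = +-cancelʳ-≤ (s ²) (begin
        s ² + s ²          ≈⟨ distribˡ s s s ⟨
        s * (s + s)        ≤⟨ *-monoʳ-≤ (proj₁ 0<2s) (proj₂ (√-isSupremum x) t bound) ⟩
        t * (s + s)        ≈⟨ t2s ⟩
        x + s ²            ∎)
      where
      0<s : 0# < s
      0<s = 0≤s , λ 0≈s → s²≰x (≤-trans (≤-reflexive (trans (*-congʳ (sym 0≈s)) (zeroˡ s))) 0≤x)
      0<2s : 0# < s + s
      0<2s = +-pos 0<s 0≤s
      t : R
      t = (x + s ²) * (s + s) ⁻¹
      t2s : t * (s + s) ≈ x + s ²
      t2s = trans (*-assoc _ _ _) (trans (*-congˡ (trans (*-comm _ _)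
              (*-inverseʳ (s + s) λ 2s≈0 → proj₂ 0<2s (sym 2s≈0)))) (*-identityʳ _))
      bound : IsUpperBound (Root x) t
      bound y root = *-cancelʳ-≤ 0<2s (begin
        y * (s + s)    ≈⟨ distribˡ y s s ⟩
        y * s + y * s  ≤⟨ am-gm 0≤x (²-nonneg s) (begin
          (y * s) ²    ≈⟨ solve 2 (λ y s → (y :* s) :* (y :* s) := (y :* y) :* (s :* s)) refl y s ⟩
          y ² * s ²    ≤⟨ *-monoʳ-≤ (²-nonneg s) (y²≤x root) ⟩
          x * s ²      ∎) ⟩
        x + s ²        ≈⟨ t2s ⟨
        t * (s + s)    ∎)
        where
        y²≤x : Root x y → y ² ≤ x
        y²≤x (inj₁ y²≤x) = y²≤x
        y²≤x (inj₂ y≈0)  = ≤-trans (≤-reflexive (trans (*-congʳ y≈0) (zeroˡ y))) 0≤x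

  √-of-square : ∀ {x} → 0# ≤ x → √ (x ²) ≈ x
  √-of-square {x} 0≤x = antisym
    (²-cancel-≤ 0≤x (≤-reflexive (√-square (²-nonneg x))))
    (²-cancel-≤ (√-nonneg _) (≤-reflexive (sym (√-square (²-nonneg x)))))

  -- Decomposition of a function into layers

  χ : Bool → R
  χ true  = 1#
  χ false = 0#

  when-χ : ∀ {P : Set} (P? : Dec P) x → (x when P?) ≈ x * χ (does P?)
  when-χ (yes _) x = sym (*-identityʳ x)
  when-χ (no _)  x = sym (zeroʳ x)

  -- A nonnegative function t is a sum of weighted indicators of the nested
  -- sets { i : level l ≤ t i }.
  record Layers (n : ℕ) {A : Set} (t : A → R) : Set where
    field
      weight         : Fin n → R
      level          : Fin n → R
      weight-nonneg  : ∀ l → 0# ≤ weight l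
      layer-sum      : ∀ i → sum (λ l → weight l when (level l ≤? t i)) ≈ t i
      level-bound    : ∀ {B} → (∀ i → t i ≤ B) → ∀ l → level l ≤ B
      ∑weight-bound  : ∀ {B} → 0# ≤ B → (∀ i → t i ≤ B) → sum weight ≤ B

  -- Induction that removes a maximal entry `t m`. By `∑weight-bound` the layers of the rest have
  -- total weight at most `t m`; the deficit `d` becomes the weight of a new layer at level `t m`.
  layers : ∀ {n} (t : Fin n → R) → (∀ i → 0# ≤ t i) → Layers n t
  layers {zero}  t 0≤t = record
    { weight        = λ ()
    ; level         = λ ()
    ; weight-nonneg = λ ()
    ; layer-sum     = λ ()
    ; level-bound   = λ _ ()
    ; ∑weight-bound = λ 0≤B _ → 0≤B
    }
  layers {suc n} t 0≤t with argmax-Fin t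
  ... | m , t≤tₘ = record
    { weight        = cons d weight
    ; level         = cons (t m) level
    ; weight-nonneg = λ { zero → proj₁ (proj₂ top) ; (suc l) → weight-nonneg l }
    ; layer-sum     = layer-sum′
    ; level-bound   = λ { t≤B zero → t≤B m ; t≤B (suc l) → level-bound (t≤B ∘ punchIn m) l }
    ; ∑weight-bound = λ 0≤B t≤B → ≤-trans (≤-reflexive (sym tₘ≈)) (t≤B m)
    }
    where
    open Layers (layers (t ∘ punchIn m) (0≤t ∘ punchIn m))
    top : ∃[ d ] (0# ≤ d × t m ≈ sum weight + d)
    top = ≤⇒difference (∑weight-bound (0≤t m) (t≤tₘ ∘ punchIn m))
    d : R
    d = proj₁ top
    tₘ≈ : t m ≈ d + sum weight
    tₘ≈ = trans (proj₂ (proj₂ top)) (+-comm (sum weight) d)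
    layer-sum′ : ∀ i → sum (λ l → cons d weight l when (cons (t m) level l ≤? t i)) ≈ t i
    layer-sum′ i with t m ≤? t i
    -- A maximal entry lies in every layer, since `level-bound` keeps the levels of the rest below
    -- `t m`. This case includes entries other than `m` that tie with it.
    ... | yes tₘ≤tᵢ = begin-equality
      d + sum (λ l → weight l when (level l ≤? t i))
        ≈⟨ +-congˡ (sum-cong-≋ λ l → when-yes (level l ≤? t i)
             (≤-trans (level-bound (t≤tₘ ∘ punchIn m) l) tₘ≤tᵢ)) ⟩
      d + sum weight                                   ≈⟨ tₘ≈ ⟨
      t m                                              ≈⟨ antisym tₘ≤tᵢ (t≤tₘ i) ⟩
      t i                                              ∎
    -- The new layer misses `i`, so `i` differs from `m` and is an entry of the rest.
    ... | no tₘ≰tᵢ = trans (+-identityˡ _) (≡.subst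
            (λ k → sum (λ l → weight l when (level l ≤? t k)) ≈ t k)
            (Fin.punchIn-punchOut m≢i) (layer-sum (punchOut m≢i)))
      where
      m≢i : ¬ m ≡ i
      m≢i ≡.refl = tₘ≰tᵢ ≤-refl

  layersᶠ : ∀ A (t : FiniteSet.Carrier A → R) → (∀ a → 0# ≤ t a) → Layers (FiniteSet.size A) t
  layersᶠ A t 0≤t = record
    { weight        = weight
    ; level         = level
    ; weight-nonneg = weight-nonneg
    ; layer-sum     = λ a → ≡.subst (λ b → sum (λ l → weight l when (level l ≤? t b)) ≈ t b)
                        (at-index a) (layer-sum (index a))
    ; level-bound   = λ t≤B → level-bound (t≤B ∘ at)
    ; ∑weight-bound = λ 0≤B t≤B → ∑weight-bound 0≤B (t≤B ∘ at)
    }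
    where
    open FiniteSet A using (at; index; at-index)
    open Layers (layers (t ∘ at) (0≤t ∘ at))

  χ-nonneg : ∀ b → 0# ≤ χ b
  χ-nonneg true  = 0≤1
  χ-nonneg false = ≤-refl

  module Cover {n} {A : Set} {t : A → R} (L : Layers n t) where
    open Layers L

    covers : Fin n → A → Bool
    covers l i = does (level l ≤? t i)

    covers-total : ∀ i → sum (λ l → weight l * χ (covers l i)) ≈ t i
    covers-total i = trans (sum-cong-≋ λ l → sym (when-χ (level l ≤? t i) (weight l))) (layer-sum i)

    -- Layers are superlevel sets, so one that contains `i` also contains every `j` with a larger
    -- value.
    covers-∧ : ∀ {i j} → t i ≤ t j → ∀ l → covers l i ∧ covers l j ≡ covers l i
    covers-∧ {i} {j} tᵢ≤tⱼ l with level l ≤? t i | level l ≤? t j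
    ... | yes _  | yes _   = ≡.refl
    ... | yes le | no  ¬le = contradiction (≤-trans le tᵢ≤tⱼ) ¬le
    ... | no  _  | _       = ≡.refl

    covers-∨ : ∀ {i j} → t i ≤ t j → ∀ l → covers l i ∨ covers l j ≡ covers l j
    covers-∨ {i} {j} tᵢ≤tⱼ l with level l ≤? t i | level l ≤? t j
    ... | yes _  | yes _   = ≡.refl
    ... | yes le | no  ¬le = contradiction (≤-trans le tᵢ≤tⱼ) ¬le
    ... | no  _  | _       = ≡.refl

    ∑-χ-cong : ∀ {x y : Fin n → Bool} → (∀ l → x l ≡ y l) →
               sum (λ l → weight l * χ (x l)) ≈ sum (λ l → weight l * χ (y l))
    ∑-χ-cong {x} x≡y = sum-cong-≋ λ l → ≡.subst (λ b → weight l * χ (x l) ≈ weight l * χ b) (x≡y l) refl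

    both either : A → A → R
    both   i j = sum λ l → weight l * χ (covers l i ∧ covers l j)
    either i j = sum λ l → weight l * χ (covers l i ∨ covers l j)

    both-either-ordered : ∀ {i j} → t i ≤ t j → both i j ≈ t i × either i j ≈ t j
    both-either-ordered {i} {j} tᵢ≤tⱼ =
      trans (∑-χ-cong (covers-∧ tᵢ≤tⱼ)) (covers-total i) , trans (∑-χ-cong (covers-∨ tᵢ≤tⱼ)) (covers-total j)

    -- both and either are the minimum and the maximum of t i and t j.
    both-either : ∀ i j → (both i j ≈ t i × either i j ≈ t j) ⊎ (both i j ≈ t j × either i j ≈ t i)
    both-either i j with total (t i) (t j)
    ... | inj₁ tᵢ≤tⱼ = inj₁ (both-either-ordered tᵢ≤tⱼ)
    ... | inj₂ tⱼ≤tᵢ with both-either-ordered tⱼ≤tᵢ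
    ...   | b , e = inj₂
      ( trans (∑-χ-cong λ l → ∧-comm (covers l i) (covers l j)) b
      , trans (∑-χ-cong λ l → ∨-comm (covers l i) (covers l j)) e)

    both-+-either : ∀ i j → both i j + either i j ≈ t i + t j
    both-+-either i j with both-either i j
    ... | inj₁ (b , e) = +-cong b e
    ... | inj₂ (b , e) = trans (+-cong b e) (+-comm _ _)

    -- Used with squared masses for `t`: the product of the two masses is then the geometric mean of
    -- `both` and `either`.
    both-*-either : ∀ i j → both i j * either i j ≈ t i * t j
    both-*-either i j with both-either i j
    ... | inj₁ (b , e) = *-cong b e
    ... | inj₂ (b , e) = trans (*-cong b e) (*-comm _ _)

    both-nonneg : ∀ i j → 0# ≤ both i j
    both-nonneg i j = sum-nonneg λ l → *-nonneg (weight-nonneg l) (χ-nonneg (covers l i ∧ covers l j))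

    either-nonneg : ∀ i j → 0# ≤ either i j
    either-nonneg i j = sum-nonneg λ l → *-nonneg (weight-nonneg l) (χ-nonneg (covers l i ∨ covers l j))

  -- Correlated rounding of partial assignments

  0≤⇒≤+ : ∀ {x y} → 0# ≤ y → x ≤ x + y
  0≤⇒≤+ {x} 0≤y = ≤-trans (≤-reflexive (sym (+-identityʳ x))) (+-monoʳ-≤ x 0≤y)

  sum-zero : ∀ {n} {f : Fin n → R} → (∀ i → f i ≈ 0#) → sum f ≈ 0#
  sum-zero {n} f≈0 = trans (sum-cong-≋ f≈0) (sum-replicate-zero n)

  term≤sum : ∀ {n} {f : Fin n → R} → (∀ i → 0# ≤ f i) → ∀ i → f i ≤ sum f
  term≤sum {suc n} {f} 0≤f i = begin
    f i                              ≤⟨ 0≤⇒≤+ (sum-nonneg λ j → 0≤f (punchIn i j)) ⟩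
    f i + sum (removeAt f i)         ≈⟨ sum-remove f ⟨
    sum f                            ∎

  -- For n ≥ 1 nonnegative weights are a multiple of a probability vector, also
  -- when they all vanish.
  record Shares {n} (w : Fin n → R) : Set where
    field
      share        : Fin n → R
      share-nonneg : ∀ j → 0# ≤ share j
      ∑share       : sum share ≈ 1#
      weight-share : ∀ j → w j ≈ sum w * share j

  abstract
    shares : ∀ {n} (w : Fin (suc n) → R) → (∀ j → 0# ≤ w j) → Shares w
    shares {n} w 0≤w with sum w ≈? 0#
    -- All weights vanish here, so any probability vector fits; the point mass at `zero` is taken.
    ... | yes W≈0 = record
      { share        = cons 1# (λ _ → 0#)
      ; share-nonneg = λ { zero → 0≤1 ; (suc j) → ≤-refl }
      ; ∑share       = trans (+-congˡ (sum-zero {n} λ _ → refl)) (+-identityʳ 1#)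
      ; weight-share = λ j → trans
          (antisym (≤-trans (term≤sum 0≤w j) (≤-reflexive W≈0)) (0≤w j))
          (sym (trans (*-congʳ W≈0) (zeroˡ _)))
      }
    ... | no  W≉0 = record
      { share        = λ j → w j * sum w ⁻¹
      ; share-nonneg = λ j → *-nonneg (0≤w j) (proj₁ (⁻¹-pos (sum-nonneg 0≤w , λ 0≈W → W≉0 (sym 0≈W))))
      ; ∑share       = trans (sym (*-distribʳ-sum (sum w ⁻¹) w)) (*-inverseʳ (sum w) W≉0)
      ; weight-share = λ j → begin-equality
          w j                       ≈⟨ *-identityʳ (w j) ⟨
          w j * 1#                  ≈⟨ *-congˡ (*-inverseʳ (sum w) W≉0) ⟨
          w j * (sum w * sum w ⁻¹)
            ≈⟨ solve 3 (λ a b c → a :* (b :* c) := b :* (a :* c)) refl (w j) (sum w) (sum w ⁻¹) ⟩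
          sum w * (w j * sum w ⁻¹)  ∎
      }

  module Race (G : ProjectionGame) where
    open ProjectionGame G hiding (weight; weight-nonneg)
    open Maximum G using (Table; deterministic; deterministic-isAssignment)

    -- The rows form a total assignment, paired with the set of vertices on which it is to be
    -- followed. Overriding one assignment by another thus gives an assignment again.
    record PartialAssignment : Set where
      field
        weight           : R
        weight-nonneg    : 0# ≤ weight
        covers           : ∣ V ∣ → Bool
        row              : Table
        row-isAssignment : IsAssignment row
    open PartialAssignment

    -- `P` is drawn before everything that went into `b`, so it takes precedence where it covers.
    override : PartialAssignment → Table → Table
    override P b v = if covers P v then row P v else b v

    override-isAssignment : ∀ P {b} → IsAssignment b → IsAssignment (override P b)
    override-isAssignment P {b} b-asg = record
      { nonneg     = nonneg′
      ; normalised = normalised′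
      }
      where
      module F = IsAssignment (row-isAssignment P)
      module B = IsAssignment b-asg
      nonneg′ : ∀ v β → 0# ≤ override P b v β
      nonneg′ v with covers P v
      ... | true  = F.nonneg v
      ... | false = B.nonneg v
      normalised′ : ∀ v → ∑ Alphabet (override P b v) ≈ 1#
      normalised′ v with covers P v
      ... | true  = F.normalised v
      ... | false = B.normalised v

    share-of : ∀ {n} (P : Fin (suc n) → PartialAssignment) → Shares (weight ∘ P)
    share-of P = shares (weight ∘ P) (weight-nonneg ∘ P)

    -- The expectation of F at the assignment in which every vertex follows the
    -- first partial assignment covering it, when these are drawn one after the
    -- other, without replacement, with probabilities proportional to weight.
    race : ∀ {n} → (Fin n → PartialAssignment) → (Table → R) → R
    -- Vertices that no partial assignment covers answer `letter`.
    race {zero}  P F = F (deterministic λ _ → letter)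
    race {suc n} P F = sum λ j → Shares.share (share-of P) j * race (P ∘ punchIn j) (F ∘ override (P j))

    race-mono : ∀ {n} (P : Fin n → PartialAssignment) {F F′} →
                (∀ b → IsAssignment b → F b ≤ F′ b) → race P F ≤ race P F′
    race-mono {zero}  P F≤F′ = F≤F′ _ (deterministic-isAssignment λ _ → letter)
    race-mono {suc n} P F≤F′ = sum-mono λ j → *-monoˡ-≤ (Shares.share-nonneg (share-of P) j)
      (race-mono (P ∘ punchIn j) λ b b-asg → F≤F′ _ (override-isAssignment (P j) b-asg))

    race-const : ∀ {n} (P : Fin n → PartialAssignment) c → race P (λ _ → c) ≈ c
    race-const {zero}  P c = refl
    race-const {suc n} P c = begin-equality
      race P (λ _ → c)                ≈⟨ sum-cong-≋ (λ j → *-congˡ {share j} (race-const (P ∘ punchIn j) c)) ⟩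
      (sum λ j → share j * c)         ≈⟨ *-distribʳ-sum c share ⟨
      sum share * c                   ≈⟨ *-congʳ ∑share ⟩
      1# * c                          ≈⟨ *-identityˡ c ⟩
      c                               ∎
      where open Shares (share-of P)

    -- Linearity of expectation. It lets the race be exchanged with the average over pairs of edges.
    race-sum : ∀ {n} (P : Fin n → PartialAssignment) {m} (c : Fin m → R) (F : Fin m → Table → R) →
               race P (λ b → sum λ i → c i * F i b) ≈ sum λ i → c i * race P (F i)
    race-sum {zero}  P c F = refl
    race-sum {suc n} P c F = begin-equality
      (sum λ j → share j * race (P ∘ punchIn j) (λ b → sum λ i → c i * F i (override (P j) b)))
        ≈⟨ sum-cong-≋ (λ j → *-congˡ {share j} (race-sum (P ∘ punchIn j) c (λ i → F i ∘ override (P j)))) ⟩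
      (sum λ j → share j * sum λ i → c i * E i j)
        ≈⟨ sum-cong-≋ (λ j → *-distribˡ-sum (share j) λ i → c i * E i j) ⟩
      (sum λ j → sum λ i → share j * (c i * E i j))
        ≈⟨ ∑-comm (λ j i → share j * (c i * E i j)) ⟩
      (sum λ i → sum λ j → share j * (c i * E i j))
        ≈⟨ sum-cong-≋ (λ i → sum-cong-≋ λ j → solve 3 (λ x y z → x :* (y :* z)
             := y :* (x :* z)) refl (share j) (c i) (E i j)) ⟩
      (sum λ i → sum λ j → c i * (share j * E i j))
        ≈⟨ sum-cong-≋ (λ i → *-distribˡ-sum (c i) λ j → share j * E i j) ⟨
      (sum λ i → c i * sum λ j → share j * E i j)  ∎
      where
      open Shares (share-of P)
      E : ∀ i j → R
      E i j = race (P ∘ punchIn j) (F i ∘ override (P j))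

    race-lower : ∀ {n} (P : Fin n → PartialAssignment) {F c} → (∀ b → IsAssignment b → c ≤ F b) → c ≤ race P F
    race-lower P {c = c} c≤F = ≤-trans (≤-reflexive (sym (race-const P c))) (race-mono P c≤F)

    race-upper : ∀ {n} (P : Fin n → PartialAssignment) {F c} → (∀ b → IsAssignment b → F b ≤ c) → race P F ≤ c
    race-upper P {c = c} F≤c = ≤-trans (race-mono P F≤c) (≤-reflexive (race-const P c))

    override-covered : ∀ P b {v} → covers P v ≡ true → override P b v ≡ row P v
    override-covered P b eq rewrite eq = ≡.refl

    override-uncovered : ∀ P b {v} → covers P v ≡ false → override P b v ≡ b v
    override-uncovered P b eq rewrite eq = ≡.refl

    module Agreement (v v′ : ∣ V ∣) (A : (∣ Alphabet ∣ → R) → (∣ Alphabet ∣ → R) → R)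
                     (A-nonneg : ∀ b → IsAssignment b → 0# ≤ A (b v) (b v′)) where

      agree both either : PartialAssignment → R
      agree  P = A (row P v) (row P v′)
      both   P = χ (covers P v ∧ covers P v′) * agree P
      either P = χ (covers P v ∨ covers P v′)

      -- Since `both` contains the factor `agree`, the first is the weight on which the two vertices
      -- are both covered and agree; the second is the weight on which at least one of them is
      -- covered.
      ∑both ∑either : ∀ {n} → (Fin n → PartialAssignment) → R
      ∑both   P = sum λ j → weight (P j) * both (P j)
      ∑either P = sum λ j → weight (P j) * either (P j)

      agree-nonneg : ∀ P → 0# ≤ agree P
      agree-nonneg P = A-nonneg (row P) (row-isAssignment P)

      both-nonneg : ∀ P → 0# ≤ both P
      both-nonneg P = *-nonneg (χ-nonneg (covers P v ∧ covers P v′)) (agree-nonneg P)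

      ∑either-nonneg : ∀ {n} (P : Fin n → PartialAssignment) → 0# ≤ ∑either P
      ∑either-nonneg P = sum-nonneg λ j → *-nonneg (weight-nonneg (P j)) (χ-nonneg (covers (P j) v ∨ covers (P j) v′))

      χ-+-not : ∀ b → χ b + χ (not b) ≈ 1#
      χ-+-not true  = +-identityʳ 1#
      χ-+-not false = +-identityˡ 1#

      weighted-zero : ∀ P {x} → x ≈ 0# → weight P * x ≈ 0#
      weighted-zero P x≈0 = trans (*-congˡ x≈0) (zeroʳ (weight P))

      -- Induction on the race, by its first draw. If the draw covers both vertices, its own
      -- agreement counts; if it covers one, nonnegativity suffices; if it covers neither, the
      -- remaining race has the same `∑both` and `∑either`. Read as a quotient, the agreement
      -- probability is at least `∑both P` over `∑either P`. A general `F` above `A` is carried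
      -- along because each draw replaces `F` by `F ∘ override (P j)`.
      race-agreement : ∀ {n} (P : Fin n → PartialAssignment) F →
                       (∀ b → IsAssignment b → A (b v) (b v′) ≤ F b) → ∑both P ≤ race P F * ∑either P
      race-agreement {zero} P F A≤F = ≤-reflexive (sym (zeroʳ (race P F)))
      race-agreement {suc n} P F A≤F = begin
        p                              ≈⟨ p≈ ⟩
        W * r                          ≈⟨ *-identityʳ (W * r) ⟨
        -- The first draw covers some of the two vertices with probability `s` and neither with
        -- probability `z`. Splitting `1#` accordingly writes `p` as `r * q + z * p`, whose terms
        -- are compared draw by draw.
        W * r * 1#                     ≈⟨ *-congˡ s+z≈1 ⟨
        W * r * (s + z)
          ≈⟨ solve 4 (λ W r s z → W :* r :* (s :+ z) := r :* (W :* s) :+ z :* (W :* r)) refl W r s z ⟩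
        r * (W * s) + z * (W * r)      ≈⟨ +-cong (*-congˡ q≈) (*-congˡ p≈) ⟨
        r * q + z * p
          ≈⟨ +-cong (*-distribʳ-sum q λ j → share j * both (P j)) (*-distribʳ-sum p λ j → share j * neither j) ⟩
        (sum λ j → share j * both (P j) * q) + (sum λ j → share j * neither j * p)
                                       ≈⟨ ∑-distrib-+ (λ j → share j * both (P j) * q) (λ j → share j * neither j * p) ⟨
        (sum λ j → share j * both (P j) * q + share j * neither j * p)
                                       ≤⟨ sum-mono step′ ⟩
        (sum λ j → share j * E j * q)  ≈⟨ *-distribʳ-sum q (λ j → share j * E j) ⟨
        race P F * q                   ∎
        where
        open Shares (share-of P)
        p q W r s z : R
        p = ∑both P
        q = ∑either P
        W = sum (weight ∘ P)
        r = sum λ j → share j * both (P j)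
        s = sum λ j → share j * either (P j)
        neither E : Fin (suc n) → R
        neither j = χ (not (covers (P j) v ∨ covers (P j) v′))
        z = sum λ j → share j * neither j
        E j = race (P ∘ punchIn j) (F ∘ override (P j))

        factor : ∀ x → (sum λ j → weight (P j) * x j) ≈ W * (sum λ j → share j * x j)
        factor x = trans
          (sum-cong-≋ λ j → trans (*-congʳ (weight-share j)) (*-assoc W (share j) (x j)))
          (sym (*-distribˡ-sum W λ j → share j * x j))
        p≈ : p ≈ W * r
        p≈ = factor (both ∘ P)
        q≈ : q ≈ W * s
        q≈ = factor (either ∘ P)
        s+z≈1 : s + z ≈ 1#
        s+z≈1 = begin-equality
          s + z
            ≈⟨ ∑-distrib-+ (λ j → share j * either (P j)) (λ j → share j * neither j) ⟨
          (sum λ j → share j * either (P j) + share j * neither j)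
            ≈⟨ sum-cong-≋ (λ j → trans (sym (distribˡ _ _ _))
                 (trans (*-congˡ {share j} (χ-+-not (covers (P j) v ∨ covers (P j) v′))) (*-identityʳ (share j)))) ⟩
          sum share                                        ≈⟨ ∑share ⟩
          1#                                               ∎

        0≤q : 0# ≤ q
        0≤q = ∑either-nonneg P

        0≤F : ∀ b → IsAssignment b → 0# ≤ F b
        0≤F b b-asg = ≤-trans (A-nonneg b b-asg) (A≤F b b-asg)

        0≤E : ∀ j → 0# ≤ E j
        0≤E j = race-lower (P ∘ punchIn j) λ b b-asg → 0≤F _ (override-isAssignment (P j) b-asg)

        one-covered : ∀ j x → 0# * x * q + 0# * p ≤ E j * q
        one-covered j x = begin
          0# * x * q + 0# * p  ≈⟨ +-cong (trans (*-congʳ (zeroˡ x)) (zeroˡ q)) (zeroˡ p) ⟩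
          0# + 0#              ≈⟨ +-identityʳ 0# ⟩
          0#                   ≤⟨ *-nonneg (0≤E j) 0≤q ⟩
          E j * q              ∎

        step : ∀ j → both (P j) * q + neither j * p ≤ E j * q
        step j with covers (P j) v in eq | covers (P j) v′ in eq′
        ... | true  | true  = begin
          1# * agree (P j) * q + 0# * p  ≈⟨ +-cong (*-congʳ (*-identityˡ _)) (zeroˡ p) ⟩
          agree (P j) * q + 0#           ≈⟨ +-identityʳ _ ⟩
          agree (P j) * q
            ≤⟨ *-monoʳ-≤ 0≤q (race-lower (P ∘ punchIn j) λ b b-asg → ≡.subst (_≤ F (override (P j) b))
                                              (≡.cong₂ A (override-covered (P j) b eq) (override-covered (P j) b eq′))
                                              (A≤F _ (override-isAssignment (P j) b-asg))) ⟩
          E j * q                        ∎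
        -- With exactly one vertex covered, the indicators in `both` and `neither` are zero, and
        -- only `0# ≤ E j * q` remains.
        ... | true  | false = one-covered j _
        ... | false | true  = one-covered j _
        -- This draw contributes zero to `p` and to `q`, so both are sums over the remaining partial
        -- assignments, where the induction hypothesis applies.
        ... | false | false = begin
          0# * agree (P j) * q + 1# * p  ≈⟨ +-cong (trans (*-congʳ (zeroˡ _)) (zeroˡ q)) (*-identityˡ p) ⟩
          0# + p                         ≈⟨ +-identityˡ p ⟩
          p                              ≈⟨ sum-remove {i = j} (λ k → weight (P k) * both (P k)) ⟩
          weight (P j) * both (P j) + ∑both (P ∘ punchIn j)
            ≈⟨ +-congʳ (weighted-zero (P j) both≈0) ⟩
          0# + ∑both (P ∘ punchIn j)     ≈⟨ +-identityˡ _ ⟩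
          ∑both (P ∘ punchIn j)
            ≤⟨ race-agreement (P ∘ punchIn j) (F ∘ override (P j)) (λ b b-asg → ≡.subst (_≤ F (override (P j) b))
                                              (≡.cong₂ A (override-uncovered (P j) b eq) (override-uncovered (P j) b eq′))
                                              (A≤F _ (override-isAssignment (P j) b-asg))) ⟩
          E j * ∑either (P ∘ punchIn j)  ≈⟨ *-congˡ (+-identityˡ _) ⟨
          E j * (0# + ∑either (P ∘ punchIn j)) ≈⟨ *-congˡ (+-congʳ (weighted-zero (P j) either≈0)) ⟨
          E j * (weight (P j) * either (P j) + ∑either (P ∘ punchIn j))
            ≈⟨ *-congˡ (sum-remove {i = j} (λ k → weight (P k) * either (P k))) ⟨
          E j * q                        ∎
          where
          both≈0 : both (P j) ≈ 0#
          both≈0 rewrite eq = zeroˡ _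
          either≈0 : either (P j) ≈ 0#
          either≈0 rewrite eq | eq′ = refl

        step′ : ∀ j → share j * both (P j) * q + share j * neither j * p ≤ share j * E j * q
        step′ j = begin
          share j * both (P j) * q + share j * neither j * p
            ≈⟨ solve 5 (λ a b q n p → a :* b :* q :+ a :* n :* p
                 := a :* (b :* q :+ n :* p)) refl (share j) (both (P j)) q (neither j) p ⟩
          share j * (both (P j) * q + neither j * p)  ≤⟨ *-monoˡ-≤ (share-nonneg j) (step j) ⟩
          share j * (E j * q)                         ≈⟨ *-assoc _ _ _ ⟨
          share j * E j * q                           ∎

  -- Sums over products, and the operator of a game

  when-*-when : ∀ {P Q S : Set} (P? : Dec P) (Q? : Dec Q) (S? : Dec S) →
                (S → P × Q) → (P → Q → S) → ∀ x y → (x * y when S?) ≈ (x when P?) * (y when Q?)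
  when-*-when (yes p) (yes q) S?    f g x y = when-yes S? (g p q)
  when-*-when (yes p) (no ¬q) S?    f g x y = trans (when-no S? (¬q ∘ proj₂ ∘ f)) (sym (zeroʳ x))
  when-*-when (no ¬p) Q?      S?    f g x y = trans (when-no S? (¬p ∘ proj₁ ∘ f)) (sym (zeroˡ _))

  when-×-dec : ∀ {P Q : Set} (P? : Dec P) (Q? : Dec Q) x → (x when (P? ×-dec Q?)) ≈ ((x when Q?) when P?)
  when-×-dec (yes _) (yes _) x = refl
  when-×-dec (yes _) (no _)  x = refl
  when-×-dec (no _)  _       x = refl

  *-when : ∀ {P : Set} (P? : Dec P) x y → (x * y when P?) ≈ x * (y when P?)
  *-when (yes _) x y = refl
  *-when (no _)  x y = sym (zeroʳ x)

  when-* : ∀ {P : Set} (P? : Dec P) x y → (x * y when P?) ≈ (x when P?) * y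
  when-* (yes _) x y = refl
  when-* (no _)  x y = sym (zeroˡ y)

  sum-when : ∀ {P : Set} (P? : Dec P) {n} (f : Fin n → R) → (sum f when P?) ≈ sum (λ i → f i when P?)
  sum-when (yes _) f = refl
  sum-when (no _) {n} f = sym (sum-zero {n} λ _ → refl)

  ∑-δ : ∀ A a → ∑ A (λ b → 1# when FiniteSet._≟_ A a b) ≈ 1#
  ∑-δ A a = begin-equality
    ∑ A (λ b → 1# when FiniteSet._≟_ A a b)
      ≈⟨ ∑-cong A _ _ (λ b → *-identityˡ (1# when FiniteSet._≟_ A a b)) ⟨
    ∑ A (λ b → 1# * (1# when FiniteSet._≟_ A a b))  ≈⟨ ∑-delta A a (λ _ → 1#) ⟩
    1#                                              ∎

  -- The argument avoids computing the enumeration of the product: insert the factor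
  -- `∑ A λ a → ∑ B λ b → δ (a , b) p`, which is `1#`, exchange the sums, and evaluate the sum over
  -- `p` by `∑-delta`.
  ∑-× : ∀ A B (f : ∣ A ∣ × ∣ B ∣ → R) → ∑ (A ×ᶠ B) f ≈ ∑ A λ a → ∑ B λ b → f (a , b)
  ∑-× A B f = begin-equality
    (∑ AB λ p → f p)
      ≈⟨ sum-cong-≋ (λ k → trans (*-congˡ {f (FiniteSet.at AB k)} (δδ (FiniteSet.at AB k))) (*-identityʳ _)) ⟨
    (∑ AB λ p → f p * (∑ A λ a → ∑ B λ b → δ (a , b) p))
      ≈⟨ sum-cong-≋ (λ k → trans (*-distribˡ-sum (f (FiniteSet.at AB k)) (λ i → ∑ B λ b → δ (FiniteSet.at A i , b)
             (FiniteSet.at AB k)))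
           (sum-cong-≋ λ i → *-distribˡ-sum (f (FiniteSet.at AB k))
             (λ j → δ (FiniteSet.at A i , FiniteSet.at B j) (FiniteSet.at AB k)))) ⟩
    (∑ AB λ p → ∑ A λ a → ∑ B λ b → f p * δ (a , b) p)
      ≈⟨ ∑-swap AB A (λ p a → ∑ B λ b → f p * δ (a , b) p) ⟩
    (∑ A λ a → ∑ AB λ p → ∑ B λ b → f p * δ (a , b) p)
      ≈⟨ sum-cong-≋ (λ i → ∑-swap AB B (λ p b → f p * δ (FiniteSet.at A i , b) p)) ⟩
    (∑ A λ a → ∑ B λ b → ∑ AB λ p → f p * δ (a , b) p)
      ≈⟨ sum-cong-≋ (λ i → sum-cong-≋ λ j → ∑-delta AB (FiniteSet.at A i , FiniteSet.at B j) f) ⟩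
    (∑ A λ a → ∑ B λ b → f (a , b))  ∎
    where
    AB : FiniteSet
    AB = A ×ᶠ B
    δ : ∣ AB ∣ → ∣ AB ∣ → R
    δ p q = 1# when FiniteSet._≟_ AB p q
    δ-× : ∀ a b a′ b′ → δ (a , b) (a′ , b′) ≈ (1# when FiniteSet._≟_ A a′ a) * (1# when FiniteSet._≟_ B b′ b)
    δ-× a b a′ b′ = trans
      (when-cong (FiniteSet._≟_ AB (a , b) (a′ , b′)) (sym (*-identityˡ 1#)))
      (when-*-when (FiniteSet._≟_ A a′ a) (FiniteSet._≟_ B b′ b) (FiniteSet._≟_ AB (a , b) (a′ , b′))
         (λ { ≡.refl → ≡.refl , ≡.refl }) (λ { ≡.refl ≡.refl → ≡.refl }) 1# 1#)
    δδ : ∀ p → (∑ A λ a → ∑ B λ b → δ (a , b) p) ≈ 1#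
    δδ (a′ , b′) = begin-equality
      (∑ A λ a → ∑ B λ b → δ (a , b) (a′ , b′))
        ≈⟨ sum-cong-≋ (λ i → trans (sum-cong-≋ λ j → δ-× (FiniteSet.at A i) (FiniteSet.at B j) a′ b′)
             (trans (sym (*-distribˡ-sum (δA i) (λ j → 1# when FiniteSet._≟_ B b′ (FiniteSet.at B j))))
               (trans (*-congˡ {δA i} (∑-δ B b′)) (*-identityʳ _)))) ⟩
      (∑ A λ a → 1# when FiniteSet._≟_ A a′ a)  ≈⟨ ∑-δ A a′ ⟩
      1#                                        ∎
      where
      δA : Fin (FiniteSet.size A) → R
      δA i = 1# when FiniteSet._≟_ A a′ (FiniteSet.at A i)

  ∑-*-∑ : ∀ A B (f : ∣ A ∣ → R) (g : ∣ B ∣ → R) → (∑ A λ a → ∑ B λ b → f a * g b) ≈ ∑ A f * ∑ B g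
  ∑-*-∑ A B f g = begin-equality
    (∑ A λ a → ∑ B λ b → f a * g b)
      ≈⟨ sum-cong-≋ (λ i → *-distribˡ-sum (f (FiniteSet.at A i)) (g ∘ FiniteSet.at B)) ⟨
    (∑ A λ a → f a * ∑ B g)          ≈⟨ *-distribʳ-sum (∑ B g) (f ∘ FiniteSet.at A) ⟨
    ∑ A f * ∑ B g                    ∎

  0<⇒≉0 : ∀ {x} → 0# < x → ¬ x ≈ 0#
  0<⇒≉0 0<x x≈0 = proj₂ 0<x (sym x≈0)

  ⁻¹-unique : ∀ {x y} → 0# < x → x * y ≈ 1# → y ≈ x ⁻¹
  ⁻¹-unique {x} {y} 0<x xy≈1 = begin-equality
    y                ≈⟨ *-identityˡ y ⟨
    1# * y           ≈⟨ *-congʳ (*-inverseʳ x (0<⇒≉0 0<x)) ⟨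
    x * x ⁻¹ * y     ≈⟨ solve 3 (λ x z y → x :* z :* y := x :* y :* z) refl x (x ⁻¹) y ⟩
    x * y * x ⁻¹     ≈⟨ *-congʳ xy≈1 ⟩
    1# * x ⁻¹        ≈⟨ *-identityˡ _ ⟩
    x ⁻¹             ∎

  *-⁻¹ : ∀ {x y} → 0# < x → 0# < y → (x * y) ⁻¹ ≈ x ⁻¹ * y ⁻¹
  *-⁻¹ {x} {y} 0<x 0<y = sym (⁻¹-unique (*-pos 0<x 0<y) (begin-equality
    x * y * (x ⁻¹ * y ⁻¹)
      ≈⟨ solve 4 (λ x y z w → x :* y :* (z :* w) := (x :* z) :* (y :* w)) refl x y (x ⁻¹) (y ⁻¹) ⟩
    (x * x ⁻¹) * (y * y ⁻¹)  ≈⟨ *-cong (*-inverseʳ x (0<⇒≉0 0<x)) (*-inverseʳ y (0<⇒≉0 0<y)) ⟩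
    1# * 1#                  ≈⟨ *-identityˡ 1# ⟩
    1#                       ∎))

  -- At most one term survives, and if none does, `0# ≤ x` gives the bound. It is applied to the
  -- letters `α` that a constraint allows for a fixed `β`.
  sum-when≤ : ∀ {n} {P : Fin n → Set} (P? : ∀ i → Dec (P i)) → (∀ {i j} → P i → P j → i ≡ j) →
              ∀ {x} → 0# ≤ x → sum (λ i → x when P? i) ≤ x
  sum-when≤ P? unique {x} 0≤x with Fin.any? P?
  ... | yes (i , Pi) = ≤-reflexive (trans
          (sum-single (λ i → x when P? i) i λ j i≢j → when-no (P? j) λ Pj → i≢j (unique Pi Pj))
          (when-yes (P? i) Pi))
  ... | no ¬∃ = ≤-trans (≤-reflexive (sum-zero λ i → when-no (P? i) λ Pi → ¬∃ (i , Pi))) 0≤x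

  open FiniteSet using (at)

  module Kernel (G : ProjectionGame) where
    open ProjectionGame G
    open Positivity G using (Pr-nonneg)

    Row : Set
    Row = ∣ Alphabet ∣ → R

    -- The conditional distribution of the edge given the question `u`.
    kernel : ∣ U ∣ → ∣ Edge ∣ → R
    kernel u e = Pr e * μU u ⁻¹ when FiniteSet._≟_ U (src e) u

    kernel-nonneg : ∀ u e → 0# ≤ kernel u e
    kernel-nonneg u e = when-nonneg (FiniteSet._≟_ U (src e) u) (*-nonneg (Pr-nonneg e) (proj₁ (⁻¹-pos (μU-pos u))))

    ∑kernel : ∀ u → ∑ Edge (kernel u) ≈ 1#
    ∑kernel u = begin-equality
      ∑ Edge (kernel u)
        ≈⟨ sum-cong-≋ (λ i → when-* (FiniteSet._≟_ U (src (at Edge i)) u) (Pr (at Edge i)) (μU u ⁻¹)) ⟩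
      (∑ Edge λ e → (Pr e when FiniteSet._≟_ U (src e) u) * μU u ⁻¹)
        ≈⟨ ∑-distrib-*ʳ Edge (μU u ⁻¹) (λ e → Pr e when FiniteSet._≟_ U (src e) u) ⟨
      μU u * μU u ⁻¹       ≈⟨ *-inverseʳ (μU u) (0<⇒≉0 (μU-pos u)) ⟩
      1#                   ∎

    ∑μU : ∑ U μU ≈ 1#
    ∑μU = begin-equality
      (∑ U λ u → ∑ Edge λ e → Pr e when FiniteSet._≟_ U (src e) u)
        ≈⟨ ∑-swap U Edge (λ u e → Pr e when FiniteSet._≟_ U (src e) u) ⟩
      (∑ Edge λ e → ∑ U λ u → Pr e when FiniteSet._≟_ U (src e) u)
        ≈⟨ sum-cong-≋ (λ i → sum-cong-≋ λ j → trans
             (when-cong (FiniteSet._≟_ U (src (at Edge i)) (at U j)) (sym (*-identityʳ (Pr (at Edge i)))))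
             (*-when (FiniteSet._≟_ U (src (at Edge i)) (at U j)) (Pr (at Edge i)) 1#)) ⟩
      (∑ Edge λ e → ∑ U λ u → Pr e * (1# when FiniteSet._≟_ U (src e) u))
        ≈⟨ sum-cong-≋ (λ i → ∑-delta U (src (at Edge i)) λ _ → Pr (at Edge i)) ⟩
      ∑ Edge Pr
        ≈⟨ ∑-distrib-*ʳ Edge (total-weight ⁻¹) weight ⟨
      total-weight * total-weight ⁻¹
        ≈⟨ *-inverseʳ total-weight (0<⇒≉0 total-weight-pos) ⟩
      1# ∎

    answer : ∣ Edge ∣ → Row → ∣ Alphabet ∣ → R
    answer e g α = ∑-where Alphabet (constraint? e α) g

    operator-kernel : ∀ f u α → operator f u α ≈ ∑ Edge λ e → kernel u e * answer e (f (tgt e)) α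
    operator-kernel f u α = sum-cong-≋ λ i →
      when-* (FiniteSet._≟_ U (src (at Edge i)) u) (Pr (at Edge i) * μU u ⁻¹) (answer (at Edge i) (f (tgt (at Edge i))) α)

    answer-cong : ∀ e {g g′ : Row} → (∀ β → g β ≈ g′ β) → ∀ α → answer e g α ≈ answer e g′ α
    answer-cong e g≈g′ α = sum-cong-≋ λ i → when-cong (constraint? e α (at Alphabet i)) (g≈g′ (at Alphabet i))

    answer-* : ∀ e k (g : Row) α → answer e (λ β → k * g β) α ≈ k * answer e g α
    answer-* e k g α = trans
      (sum-cong-≋ λ i → *-when (constraint? e α (at Alphabet i)) k (g (at Alphabet i)))
      (sym (*-distribˡ-sum k λ i → g (at Alphabet i) when constraint? e α (at Alphabet i)))

    answer-sum : ∀ e {n} (g : Fin n → Row) α → answer e (λ β → sum λ j → g j β) α ≈ sum λ j → answer e (g j) α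
    answer-sum e g α = trans
      (sum-cong-≋ λ i → sum-when (constraint? e α (at Alphabet i)) λ j → g j (at Alphabet i))
      (∑-comm λ i j → g j (at Alphabet i) when constraint? e α (at Alphabet i))

    operator-sum : ∀ {n} (f : Fin n → ∣ V ∣ → Row) u α →
                   operator (λ v β → sum λ j → f j v β) u α ≈ sum λ j → operator (f j) u α
    operator-sum f u α = begin-equality
      operator (λ v β → sum λ j → f j v β) u α  ≈⟨ operator-kernel (λ v β → sum λ j → f j v β) u α ⟩
      (∑ Edge λ e → kernel u e * answer e (λ β → sum λ j → f j (tgt e) β) α)
        ≈⟨ sum-cong-≋ (λ i → trans (*-congˡ {kernel u (at Edge i)} (answer-sum (at Edge i) (λ j → f j (tgt (at Edge i))) α))
             (*-distribˡ-sum (kernel u (at Edge i)) λ j → answer (at Edge i) (f j (tgt (at Edge i))) α)) ⟩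
      (∑ Edge λ e → sum λ j → kernel u e * answer e (f j (tgt e)) α)
        ≈⟨ ∑-comm (λ i j → kernel u (at Edge i) * answer (at Edge i) (f j (tgt (at Edge i))) α) ⟩
      (sum λ j → ∑ Edge λ e → kernel u e * answer e (f j (tgt e)) α)
        ≈⟨ sum-cong-≋ (λ j → operator-kernel (f j) u α) ⟨
      (sum λ j → operator (f j) u α)            ∎

    answer-nonneg : ∀ e {g : Row} → (∀ β → 0# ≤ g β) → ∀ α → 0# ≤ answer e g α
    answer-nonneg e 0≤g α = sum-nonneg λ i → when-nonneg (constraint? e α (at Alphabet i)) (0≤g (at Alphabet i))

    operator-nonneg : ∀ {f} → (∀ v β → 0# ≤ f v β) → ∀ u α → 0# ≤ operator f u α
    operator-nonneg {f} 0≤f u α = ≤-trans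
      (sum-nonneg λ i → *-nonneg (kernel-nonneg u (at Edge i)) (answer-nonneg (at Edge i) (0≤f (tgt (at Edge i))) α))
      (≤-reflexive (sym (operator-kernel f u α)))

    -- By the projection property the mass of each `β` goes to at most one `α`, so mass may be lost
    -- but is never duplicated.
    ∑answer : ∀ e {g : Row} → (∀ β → 0# ≤ g β) → ∑ Alphabet (answer e g) ≤ ∑ Alphabet g
    ∑answer e {g} 0≤g = begin
      (∑ Alphabet λ α → ∑ Alphabet λ β → g β when constraint? e α β)
        ≈⟨ ∑-swap Alphabet Alphabet (λ α β → g β when constraint? e α β) ⟩
      (∑ Alphabet λ β → ∑ Alphabet λ α → g β when constraint? e α β)
        ≤⟨ sum-mono (λ j → sum-when≤ (λ i → constraint? e (at Alphabet i) (at Alphabet j))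
             (λ p q → Injection.injective (Inverse⇒Injection (FiniteSet.enum Alphabet)) (projection e p q))
             (0≤g (at Alphabet j))) ⟩
      ∑ Alphabet g  ∎

    -- For probability rows this is the probability that independent letters from `g` and `g′`, sent
    -- through the constraints of `e` and `e′`, arrive at the same letter.
    collision : ∣ Edge ∣ → ∣ Edge ∣ → Row → Row → R
    collision e e′ g g′ = ∑ Alphabet λ α → answer e g α * answer e′ g′ α

    collision-nonneg : ∀ e e′ {g g′} → (∀ β → 0# ≤ g β) → (∀ β → 0# ≤ g′ β) → 0# ≤ collision e e′ g g′
    collision-nonneg e e′ 0≤g 0≤g′ = sum-nonneg λ i →
      *-nonneg (answer-nonneg e 0≤g (at Alphabet i)) (answer-nonneg e′ 0≤g′ (at Alphabet i))

    collision-≤1 : ∀ e e′ {g g′} → (∀ β → 0# ≤ g β) → (∀ β → 0# ≤ g′ β) →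
                   ∑ Alphabet g ≈ 1# → ∑ Alphabet g′ ≈ 1# → collision e e′ g g′ ≤ 1#
    collision-≤1 e e′ {g} {g′} 0≤g 0≤g′ ∑g ∑g′ = begin
      (∑ Alphabet λ α → answer e g α * answer e′ g′ α)
        ≤⟨ sum-mono (λ i → *-monoˡ-≤ (answer-nonneg e 0≤g (at Alphabet i)) (begin
             answer e′ g′ (at Alphabet i)  ≤⟨ term≤sum (λ j → answer-nonneg e′ 0≤g′ (at Alphabet j)) i ⟩
             ∑ Alphabet (answer e′ g′)     ≤⟨ ∑answer e′ 0≤g′ ⟩
             ∑ Alphabet g′                 ≈⟨ ∑g′ ⟩
             1#                            ∎)) ⟩
      (∑ Alphabet λ α → answer e g α * 1#)  ≈⟨ sum-cong-≋ (λ i → *-identityʳ (answer e g (at Alphabet i))) ⟩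
      ∑ Alphabet (answer e g)               ≤⟨ ∑answer e 0≤g ⟩
      ∑ Alphabet g                          ≈⟨ ∑g ⟩
      1#                                    ∎

    collision-cong : ∀ e e′ {g g₁ g′ g₁′ : Row} → (∀ β → g β ≈ g₁ β) → (∀ β → g′ β ≈ g₁′ β) →
                     collision e e′ g g′ ≈ collision e e′ g₁ g₁′
    collision-cong e e′ g≈ g′≈ = sum-cong-≋ λ i →
      *-cong (answer-cong e g≈ (at Alphabet i)) (answer-cong e′ g′≈ (at Alphabet i))

    collision-* : ∀ e e′ k k′ g g′ →
                  collision e e′ (λ β → k * g β) (λ β → k′ * g′ β) ≈ k * k′ * collision e e′ g g′
    collision-* e e′ k k′ g g′ = trans
      (sum-cong-≋ λ i → trans
        (*-cong (answer-* e k g (at Alphabet i)) (answer-* e′ k′ g′ (at Alphabet i)))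
        (solve 4 (λ k x k′ y → (k :* x) :* (k′ :* y) := k :* k′ :* (x :* y)) refl
          k (answer e g (at Alphabet i)) k′ (answer e′ g′ (at Alphabet i))))
      (sym (*-distribˡ-sum (k * k′) λ i → answer e g (at Alphabet i) * answer e′ g′ (at Alphabet i)))

    -- Two edges drawn independently at the same random question of U.
    Pair : FiniteSet
    Pair = U ×ᶠ Edge ×ᶠ Edge

    PrPair : ∣ Pair ∣ → R
    PrPair (u , e , e′) = μU u * (kernel u e * kernel u e′)

    PrPair-nonneg : ∀ i → 0# ≤ PrPair i
    PrPair-nonneg (u , e , e′) = *-nonneg (proj₁ (μU-pos u)) (*-nonneg (kernel-nonneg u e) (kernel-nonneg u e′))

    ∑Pair : ∀ f → ∑ Pair f ≈ ∑ U λ u → ∑ Edge λ e → ∑ Edge λ e′ → f (u , e , e′)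
    ∑Pair f = trans (∑-× U (Edge ×ᶠ Edge) f) (sum-cong-≋ λ i → ∑-× Edge Edge λ p → f (at U i , p))

    ∑PrPair : ∑ Pair PrPair ≈ 1#
    ∑PrPair = begin-equality
      ∑ Pair PrPair  ≈⟨ ∑Pair PrPair ⟩
      (∑ U λ u → ∑ Edge λ e → ∑ Edge λ e′ → μU u * (kernel u e * kernel u e′))
        ≈⟨ sum-cong-≋ (λ i → trans
             (sum-cong-≋ λ j → sym (*-distribˡ-sum (μU (at U i)) λ k → kernel (at U i) (at Edge j) * kernel (at U i) (at Edge k)))
             (sym (*-distribˡ-sum (μU (at U i)) λ j → ∑ Edge λ e′ → kernel (at U i) (at Edge j) * kernel (at U i) e′))) ⟩
      (∑ U λ u → μU u * (∑ Edge λ e → ∑ Edge λ e′ → kernel u e * kernel u e′))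
        ≈⟨ sum-cong-≋ (λ i → trans
             (*-congˡ {μU (at U i)} (trans (∑-*-∑ Edge Edge (kernel (at U i)) (kernel (at U i)))
               (trans (*-cong (∑kernel (at U i)) (∑kernel (at U i))) (*-identityˡ 1#))))
             (*-identityʳ (μU (at U i)))) ⟩
      ∑ U μU         ≈⟨ ∑μU ⟩
      1#             ∎

    collide : (∣ V ∣ → Row) → ∣ Pair ∣ → R
    collide f (u , e , e′) = collision e e′ (f (tgt e)) (f (tgt e′))

    collide-nonneg : ∀ {f} → IsAssignment f → ∀ i → 0# ≤ collide f i
    collide-nonneg f-asg (u , e , e′) = collision-nonneg e e′ (nonneg (tgt e)) (nonneg (tgt e′))
      where open IsAssignment f-asg

    collide-≤1 : ∀ {f} → IsAssignment f → ∀ i → collide f i ≤ 1#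
    collide-≤1 f-asg (u , e , e′) =
      collision-≤1 e e′ (nonneg (tgt e)) (nonneg (tgt e′)) (normalised (tgt e)) (normalised (tgt e′))
      where open IsAssignment f-asg

    -- The square of an average over the edges at `u` is an average over two independent edges at
    -- `u`, and summing over `α` turns the product of their answers into a collision.
    norm²-operator : ∀ f → norm² (operator f) ≈ ∑ Pair λ i → PrPair i * collide f i
    norm²-operator f = begin-equality
      (∑ U λ u → μU u * ∑ Alphabet λ α → operator f u α ²)
        ≈⟨ sum-cong-≋ (λ i → at-u (at U i)) ⟩
      (∑ U λ u → ∑ Edge λ e → ∑ Edge λ e′ → PrPair (u , e , e′) * collide f (u , e , e′))
        ≈⟨ ∑Pair (λ i → PrPair i * collide f i) ⟨
      (∑ Pair λ i → PrPair i * collide f i)  ∎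
      where
      ans : ∣ Edge ∣ → ∣ Alphabet ∣ → R
      ans e = answer e (f (tgt e))
      at-u : ∀ u → (μU u * ∑ Alphabet λ α → operator f u α ²)
                 ≈ ∑ Edge λ e → ∑ Edge λ e′ → PrPair (u , e , e′) * collide f (u , e , e′)
      at-u u = begin-equality
        (μU u * ∑ Alphabet λ α → operator f u α ²)
          ≈⟨ *-congˡ (sum-cong-≋ λ i → trans
               (*-cong (operator-kernel f u (at Alphabet i)) (operator-kernel f u (at Alphabet i)))
               (sym (∑-*-∑ Edge Edge (λ e → kernel u e * ans e (at Alphabet i)) (λ e → kernel u e * ans e (at Alphabet i))))) ⟩
        (μU u * ∑ Alphabet λ α → ∑ Edge λ e → ∑ Edge λ e′ → kernel u e * ans e α * (kernel u e′ * ans e′ α))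
          ≈⟨ *-congˡ (∑-swap Alphabet Edge λ α e → ∑ Edge λ e′ → kernel u e * ans e α * (kernel u e′ * ans e′ α)) ⟩
        (μU u * ∑ Edge λ e → ∑ Alphabet λ α → ∑ Edge λ e′ → kernel u e * ans e α * (kernel u e′ * ans e′ α))
          ≈⟨ *-congˡ (sum-cong-≋ λ j → ∑-swap Alphabet Edge λ α e′ →
               kernel u (at Edge j) * ans (at Edge j) α * (kernel u e′ * ans e′ α)) ⟩
        (μU u * ∑ Edge λ e → ∑ Edge λ e′ → ∑ Alphabet λ α → kernel u e * ans e α * (kernel u e′ * ans e′ α))
          ≈⟨ *-distribˡ-sum (μU u) (λ j → ∑ Edge λ e′ → ∑ Alphabet λ α →
               kernel u (at Edge j) * ans (at Edge j) α * (kernel u e′ * ans e′ α)) ⟩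
        (∑ Edge λ e → μU u * ∑ Edge λ e′ → ∑ Alphabet λ α → kernel u e * ans e α * (kernel u e′ * ans e′ α))
          ≈⟨ sum-cong-≋ (λ j → trans
               (*-distribˡ-sum (μU u) λ k → ∑ Alphabet λ α →
                 kernel u (at Edge j) * ans (at Edge j) α * (kernel u (at Edge k) * ans (at Edge k) α))
               (sum-cong-≋ λ k → gather u (at Edge j) (at Edge k))) ⟩
        (∑ Edge λ e → ∑ Edge λ e′ → PrPair (u , e , e′) * collide f (u , e , e′))  ∎
        where
        gather : ∀ u e e′ → (μU u * ∑ Alphabet λ α → kernel u e * ans e α * (kernel u e′ * ans e′ α))
                          ≈ PrPair (u , e , e′) * collide f (u , e , e′)
        gather u e e′ = begin-equality
          (μU u * ∑ Alphabet λ α → kernel u e * ans e α * (kernel u e′ * ans e′ α))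
            ≈⟨ *-congˡ (sum-cong-≋ λ i → solve 4 (λ a x b y → a :* x :* (b :* y) := a :* b :* (x :* y)) refl
                 (kernel u e) (ans e (at Alphabet i)) (kernel u e′) (ans e′ (at Alphabet i))) ⟩
          (μU u * ∑ Alphabet λ α → kernel u e * kernel u e′ * (ans e α * ans e′ α))
            ≈⟨ *-congˡ (*-distribˡ-sum (kernel u e * kernel u e′) λ i → ans e (at Alphabet i) * ans e′ (at Alphabet i)) ⟨
          μU u * (kernel u e * kernel u e′ * collide f (u , e , e′))
            ≈⟨ *-assoc _ _ _ ⟨
          PrPair (u , e , e′) * collide f (u , e , e′)  ∎

  -- Slices of a tensor product

  module Slice (G H : ProjectionGame) where
    private
      module G = ProjectionGame G
      module H = ProjectionGame H
      module GH = ProjectionGame (G ⊗ H)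
      module KG = Kernel G
      module KH = Kernel H
      module KGH = Kernel (G ⊗ H)

    total-weight-⊗ : GH.total-weight ≈ G.total-weight * H.total-weight
    total-weight-⊗ = trans (∑-× G.Edge H.Edge GH.weight) (∑-*-∑ G.Edge H.Edge G.weight H.weight)

    Pr-⊗ : ∀ e e′ → GH.Pr (e , e′) ≈ G.Pr e * H.Pr e′
    Pr-⊗ e e′ = begin-equality
      G.weight e * H.weight e′ * GH.total-weight ⁻¹
        ≈⟨ *-congˡ (trans (⁻¹-cong total-weight-⊗) (*-⁻¹ G.total-weight-pos H.total-weight-pos)) ⟩
      G.weight e * H.weight e′ * (G.total-weight ⁻¹ * H.total-weight ⁻¹)
        ≈⟨ solve 4 (λ a b c d → a :* b :* (c :* d) := (a :* c) :* (b :* d)) refl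
             (G.weight e) (H.weight e′) (G.total-weight ⁻¹) (H.total-weight ⁻¹) ⟩
      G.Pr e * H.Pr e′  ∎

    src-when : ∀ u u′ e e′ x y →
               (x * y when FiniteSet._≟_ GH.U (GH.src (e , e′)) (u , u′))
               ≈ (x when FiniteSet._≟_ G.U (G.src e) u) * (y when FiniteSet._≟_ H.U (H.src e′) u′)
    src-when u u′ e e′ = when-*-when
      (FiniteSet._≟_ G.U (G.src e) u) (FiniteSet._≟_ H.U (H.src e′) u′)
      (FiniteSet._≟_ GH.U (GH.src (e , e′)) (u , u′))
      (λ eq → ≡.cong proj₁ eq , ≡.cong proj₂ eq) (≡.cong₂ _,_)

    μU-⊗ : ∀ u u′ → GH.μU (u , u′) ≈ G.μU u * H.μU u′
    μU-⊗ u u′ = begin-equality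
      GH.μU (u , u′)
        ≈⟨ ∑-× G.Edge H.Edge (λ e → GH.Pr e when FiniteSet._≟_ GH.U (GH.src e) (u , u′)) ⟩
      (∑ G.Edge λ e → ∑ H.Edge λ e′ → GH.Pr (e , e′) when FiniteSet._≟_ GH.U (GH.src (e , e′)) (u , u′))
        ≈⟨ sum-cong-≋ (λ i → sum-cong-≋ λ j → trans
             (when-cong (FiniteSet._≟_ GH.U (GH.src (at G.Edge i , at H.Edge j)) (u , u′)) (Pr-⊗ (at G.Edge i) (at H.Edge j)))
             (src-when u u′ (at G.Edge i) (at H.Edge j) (G.Pr (at G.Edge i)) (H.Pr (at H.Edge j)))) ⟩
      (∑ G.Edge λ e → ∑ H.Edge λ e′ → (G.Pr e when FiniteSet._≟_ G.U (G.src e) u) * (H.Pr e′ when FiniteSet._≟_ H.U (H.src e′) u′))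
        ≈⟨ ∑-*-∑ G.Edge H.Edge (λ e → G.Pr e when FiniteSet._≟_ G.U (G.src e) u)
                    (λ e′ → H.Pr e′ when FiniteSet._≟_ H.U (H.src e′) u′) ⟩
      G.μU u * H.μU u′  ∎

    kernel-⊗ : ∀ u u′ e e′ → KGH.kernel (u , u′) (e , e′) ≈ KG.kernel u e * KH.kernel u′ e′
    kernel-⊗ u u′ e e′ = trans
      (when-cong (FiniteSet._≟_ GH.U (GH.src (e , e′)) (u , u′)) (begin-equality
        GH.Pr (e , e′) * GH.μU (u , u′) ⁻¹
          ≈⟨ *-cong (Pr-⊗ e e′) (trans (⁻¹-cong (μU-⊗ u u′)) (*-⁻¹ (G.μU-pos u) (H.μU-pos u′))) ⟩
        G.Pr e * H.Pr e′ * (G.μU u ⁻¹ * H.μU u′ ⁻¹)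
          ≈⟨ solve 4 (λ a b c d → a :* b :* (c :* d) := (a :* c) :* (b :* d)) refl
               (G.Pr e) (H.Pr e′) (G.μU u ⁻¹) (H.μU u′ ⁻¹) ⟩
        (G.Pr e * G.μU u ⁻¹) * (H.Pr e′ * H.μU u′ ⁻¹)  ∎))
      (src-when u u′ e e′ (G.Pr e * G.μU u ⁻¹) (H.Pr e′ * H.μU u′ ⁻¹))

    answer-⊗ : ∀ e e′ g α α′ →
               KGH.answer (e , e′) g (α , α′) ≈ KG.answer e (λ β → KH.answer e′ (λ β′ → g (β , β′)) α′) α
    answer-⊗ e e′ g α α′ = begin-equality
      KGH.answer (e , e′) g (α , α′)
        ≈⟨ ∑-× G.Alphabet H.Alphabet (λ β → g β when GH.constraint? (e , e′) (α , α′) β) ⟩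
      (∑ G.Alphabet λ β → ∑ H.Alphabet λ β′ → g (β , β′) when (G.constraint? e α β ×-dec H.constraint? e′ α′ β′))
        ≈⟨ sum-cong-≋ (λ i → trans
             (sum-cong-≋ λ j → when-×-dec (G.constraint? e α (at G.Alphabet i)) (H.constraint? e′ α′ (at H.Alphabet j))
                 (g (at G.Alphabet i , at H.Alphabet j)))
             (sym (sum-when (G.constraint? e α (at G.Alphabet i)) λ j → g (at G.Alphabet i , at H.Alphabet j)
                 when H.constraint? e′ α′ (at H.Alphabet j)))) ⟩
      KG.answer e (λ β → KH.answer e′ (λ β′ → g (β , β′)) α′) α  ∎

    module _ (f : ∣ GH.V ∣ → ∣ GH.Alphabet ∣ → R) where

      section : ∣ G.V ∣ → ∣ G.Alphabet ∣ → ∣ H.V ∣ → ∣ H.Alphabet ∣ → R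
      section v β v′ β′ = f (v , v′) (β , β′)

      -- The family `h ω` of the outline: `Id ⊗ H` applied to `f`, read at the question and answer
      -- `ω` of `H`.
      slice : ∣ H.U ×ᶠ H.Alphabet ∣ → ∣ G.V ∣ → ∣ G.Alphabet ∣ → R
      slice (u′ , α′) v β = H.operator (section v β) u′ α′

      -- `G ⊗ H` is `G ⊗ Id` after `Id ⊗ H`: the kernel and the constraint sums factor, and
      -- linearity of `KG.answer` moves the sum over edges of `H` inside.
      operator-⊗ : ∀ u u′ α α′ → GH.operator f (u , u′) (α , α′) ≈ G.operator (slice (u′ , α′)) u α
      operator-⊗ u u′ α α′ = begin-equality
        GH.operator f (u , u′) (α , α′)
          ≈⟨ KGH.operator-kernel f (u , u′) (α , α′) ⟩
        (∑ GH.Edge λ e → KGH.kernel (u , u′) e * KGH.answer e (f (GH.tgt e)) (α , α′))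
          ≈⟨ ∑-× G.Edge H.Edge (λ e → KGH.kernel (u , u′) e * KGH.answer e (f (GH.tgt e)) (α , α′)) ⟩
        (∑ G.Edge λ e → ∑ H.Edge λ e′ → KGH.kernel (u , u′) (e , e′) * KGH.answer (e , e′) (f (G.tgt e , H.tgt e′)) (α , α′))
          ≈⟨ sum-cong-≋ (λ i → at-e (at G.Edge i)) ⟩
        (∑ G.Edge λ e → KG.kernel u e * KG.answer e (slice (u′ , α′) (G.tgt e)) α)
          ≈⟨ KG.operator-kernel (slice (u′ , α′)) u α ⟨
        G.operator (slice (u′ , α′)) u α  ∎
        where
        answerH : ∣ G.Edge ∣ → ∣ H.Edge ∣ → ∣ G.Alphabet ∣ → R
        answerH e e′ β = KH.answer e′ (section (G.tgt e) β (H.tgt e′)) α′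
        at-e : ∀ e → (∑ H.Edge λ e′ → KGH.kernel (u , u′) (e , e′) * KGH.answer (e , e′) (f (G.tgt e , H.tgt e′)) (α , α′))
                   ≈ KG.kernel u e * KG.answer e (slice (u′ , α′) (G.tgt e)) α
        at-e e = begin-equality
          (∑ H.Edge λ e′ → KGH.kernel (u , u′) (e , e′) * KGH.answer (e , e′) (f (G.tgt e , H.tgt e′)) (α , α′))
            ≈⟨ sum-cong-≋ (λ j → begin-equality
                 KGH.kernel (u , u′) (e , at H.Edge j) * KGH.answer (e , at H.Edge j) (f (G.tgt e , H.tgt (at H.Edge j))) (α , α′)
                   ≈⟨ *-cong (kernel-⊗ u u′ e (at H.Edge j)) (answer-⊗ e (at H.Edge j) (f (G.tgt e , H.tgt (at H.Edge j))) α α′) ⟩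
                 KG.kernel u e * KH.kernel u′ (at H.Edge j) * KG.answer e (answerH e (at H.Edge j)) α
                   ≈⟨ *-assoc _ _ _ ⟩
                 KG.kernel u e * (KH.kernel u′ (at H.Edge j) * KG.answer e (answerH e (at H.Edge j)) α)
                   ≈⟨ *-congˡ (KG.answer-* e (KH.kernel u′ (at H.Edge j)) (answerH e (at H.Edge j)) α) ⟨
                 KG.kernel u e * KG.answer e (λ β → KH.kernel u′ (at H.Edge j) * answerH e (at H.Edge j) β) α  ∎) ⟩
          (∑ H.Edge λ e′ → KG.kernel u e * KG.answer e (λ β → KH.kernel u′ e′ * answerH e e′ β) α)
            ≈⟨ *-distribˡ-sum (KG.kernel u e) (λ j → KG.answer e (λ β → KH.kernel u′ (at H.Edge j) * answerH e (at H.Edge j) β) α) ⟨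
          (KG.kernel u e * ∑ H.Edge λ e′ → KG.answer e (λ β → KH.kernel u′ e′ * answerH e e′ β) α)
            ≈⟨ *-congˡ (KG.answer-sum e (λ j β → KH.kernel u′ (at H.Edge j) * answerH e (at H.Edge j) β) α) ⟨
          KG.kernel u e * KG.answer e (λ β → ∑ H.Edge λ e′ → KH.kernel u′ e′ * answerH e e′ β) α
            ≈⟨ *-congˡ (KG.answer-cong e (λ β → KH.operator-kernel (section (G.tgt e) β) u′ α′) α) ⟨
          KG.kernel u e * KG.answer e (slice (u′ , α′) (G.tgt e)) α  ∎

      -- `G ⊗ Id` acts on each slice separately and the measure on `U` factors, so the sums over `u`
      -- and `α` regroup into a norm for each `ω`.
      norm²-⊗ : GH.norm² (GH.operator f)
                ≈ ∑ (H.U ×ᶠ H.Alphabet) λ ω → H.μU (proj₁ ω) * G.norm² (G.operator (slice ω))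
      norm²-⊗ = begin-equality
        (∑ GH.U λ u → GH.μU u * ∑ GH.Alphabet λ α → GH.operator f u α ²)
          ≈⟨ ∑-× G.U H.U (λ u → GH.μU u * ∑ GH.Alphabet λ α → GH.operator f u α ²) ⟩
        (∑ G.U λ u → ∑ H.U λ u′ → GH.μU (u , u′) * ∑ GH.Alphabet λ α → GH.operator f (u , u′) α ²)
          ≈⟨ ∑-swap G.U H.U (λ u u′ → GH.μU (u , u′) * ∑ GH.Alphabet λ α → GH.operator f (u , u′) α ²) ⟩
        (∑ H.U λ u′ → ∑ G.U λ u → GH.μU (u , u′) * ∑ GH.Alphabet λ α → GH.operator f (u , u′) α ²)
          ≈⟨ sum-cong-≋ (λ i → at-u′ (at H.U i)) ⟩
        (∑ H.U λ u′ → ∑ H.Alphabet λ α′ → H.μU u′ * G.norm² (G.operator (slice (u′ , α′))))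
          ≈⟨ ∑-× H.U H.Alphabet (λ ω → H.μU (proj₁ ω) * G.norm² (G.operator (slice ω))) ⟨
        (∑ (H.U ×ᶠ H.Alphabet) λ ω → H.μU (proj₁ ω) * G.norm² (G.operator (slice ω)))  ∎
        where
        Gs : ∀ u u′ → ∣ G.Alphabet ∣ → ∣ H.Alphabet ∣ → R
        Gs u u′ α α′ = G.operator (slice (u′ , α′)) u α ²
        at-u : ∀ u u′ → GH.μU (u , u′) * (∑ GH.Alphabet λ α → GH.operator f (u , u′) α ²)
                      ≈ H.μU u′ * (∑ H.Alphabet λ α′ → G.μU u * ∑ G.Alphabet λ α → Gs u u′ α α′)
        at-u u u′ = begin-equality
          GH.μU (u , u′) * (∑ GH.Alphabet λ α → GH.operator f (u , u′) α ²)
            ≈⟨ *-cong (trans (μU-⊗ u u′) (*-comm (G.μU u) (H.μU u′)))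
                 (trans (∑-× G.Alphabet H.Alphabet (λ α → GH.operator f (u , u′) α ²))
                   (sum-cong-≋ λ i → sum-cong-≋ λ j → *-cong (operator-⊗ u u′ (at G.Alphabet i) (at H.Alphabet j))
                                                             (operator-⊗ u u′ (at G.Alphabet i) (at H.Alphabet j)))) ⟩
          H.μU u′ * G.μU u * (∑ G.Alphabet λ α → ∑ H.Alphabet λ α′ → Gs u u′ α α′)
            ≈⟨ *-assoc _ _ _ ⟩
          H.μU u′ * (G.μU u * (∑ G.Alphabet λ α → ∑ H.Alphabet λ α′ → Gs u u′ α α′))
            ≈⟨ *-congˡ (*-congˡ (∑-swap G.Alphabet H.Alphabet (Gs u u′))) ⟩
          H.μU u′ * (G.μU u * (∑ H.Alphabet λ α′ → ∑ G.Alphabet λ α → Gs u u′ α α′))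
            ≈⟨ *-congˡ (*-distribˡ-sum (G.μU u) λ j → ∑ G.Alphabet λ α → Gs u u′ α (at H.Alphabet j)) ⟩
          H.μU u′ * (∑ H.Alphabet λ α′ → G.μU u * ∑ G.Alphabet λ α → Gs u u′ α α′)  ∎
        at-u′ : ∀ u′ → (∑ G.U λ u → GH.μU (u , u′) * ∑ GH.Alphabet λ α → GH.operator f (u , u′) α ²)
                     ≈ ∑ H.Alphabet λ α′ → H.μU u′ * G.norm² (G.operator (slice (u′ , α′)))
        at-u′ u′ = begin-equality
          (∑ G.U λ u → GH.μU (u , u′) * ∑ GH.Alphabet λ α → GH.operator f (u , u′) α ²)
            ≈⟨ sum-cong-≋ (λ i → at-u (at G.U i) u′) ⟩
          (∑ G.U λ u → H.μU u′ * (∑ H.Alphabet λ α′ → G.μU u * ∑ G.Alphabet λ α → Gs u u′ α α′))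
            ≈⟨ *-distribˡ-sum (H.μU u′) (λ i → ∑ H.Alphabet λ α′ → G.μU (at G.U i) * ∑ G.Alphabet λ α → Gs (at G.U i) u′ α α′) ⟨
          (H.μU u′ * ∑ G.U λ u → ∑ H.Alphabet λ α′ → G.μU u * ∑ G.Alphabet λ α → Gs u u′ α α′)
            ≈⟨ *-congˡ (∑-swap G.U H.Alphabet λ u α′ → G.μU u * ∑ G.Alphabet λ α → Gs u u′ α α′) ⟩
          (H.μU u′ * ∑ H.Alphabet λ α′ → G.norm² (G.operator (slice (u′ , α′))))
            ≈⟨ *-distribˡ-sum (H.μU u′) (λ j → G.norm² (G.operator (slice (u′ , at H.Alphabet j)))) ⟩
          (∑ H.Alphabet λ α′ → H.μU u′ * G.norm² (G.operator (slice (u′ , α′))))  ∎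

      marginal : ∣ G.V ∣ → ∣ H.V ∣ → ∣ H.Alphabet ∣ → R
      marginal v v′ β′ = ∑ G.Alphabet λ β → section v β v′ β′

      marginal-isAssignment : GH.IsAssignment f → ∀ v → H.IsAssignment (marginal v)
      marginal-isAssignment f-asg v = record
        { nonneg     = λ v′ β′ → sum-nonneg λ i → nonneg (v , v′) (at G.Alphabet i , β′)
        ; normalised = λ v′ → begin-equality
            (∑ H.Alphabet λ β′ → ∑ G.Alphabet λ β → f (v , v′) (β , β′))
              ≈⟨ ∑-swap G.Alphabet H.Alphabet (λ β β′ → f (v , v′) (β , β′)) ⟨
            (∑ G.Alphabet λ β → ∑ H.Alphabet λ β′ → f (v , v′) (β , β′))
              ≈⟨ ∑-× G.Alphabet H.Alphabet (f (v , v′)) ⟨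
            ∑ GH.Alphabet (f (v , v′))
              ≈⟨ normalised (v , v′) ⟩
            1# ∎
        }
        where open GH.IsAssignment f-asg

      -- `H` is linear, so the mass of `slice ω v` is the value at `ω` of `H` applied to
      -- `marginal v`.
      ∑slice² : ∀ v → (∑ (H.U ×ᶠ H.Alphabet) λ ω → H.μU (proj₁ ω) * ∑ G.Alphabet (slice ω v) ²)
                    ≈ H.norm² (H.operator (marginal v))
      ∑slice² v = begin-equality
        (∑ (H.U ×ᶠ H.Alphabet) λ ω → H.μU (proj₁ ω) * ∑ G.Alphabet (slice ω v) ²)
          ≈⟨ ∑-× H.U H.Alphabet (λ ω → H.μU (proj₁ ω) * ∑ G.Alphabet (slice ω v) ²) ⟩
        (∑ H.U λ u′ → ∑ H.Alphabet λ α′ → H.μU u′ * ∑ G.Alphabet (slice (u′ , α′) v) ²)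
          ≈⟨ sum-cong-≋ (λ i → *-distribˡ-sum (H.μU (at H.U i)) λ j → ∑ G.Alphabet (slice (at H.U i , at H.Alphabet j) v) ²) ⟨
        (∑ H.U λ u′ → H.μU u′ * ∑ H.Alphabet λ α′ → ∑ G.Alphabet (slice (u′ , α′) v) ²)
          ≈⟨ sum-cong-≋ (λ i → *-congˡ {H.μU (at H.U i)}
               (sum-cong-≋ λ j → *-cong (linear (at H.U i) (at H.Alphabet j)) (linear (at H.U i) (at H.Alphabet j)))) ⟨
        H.norm² (H.operator (marginal v))  ∎
        where
        linear : ∀ u′ α′ → H.operator (marginal v) u′ α′ ≈ ∑ G.Alphabet (slice (u′ , α′) v)
        linear = KH.operator-sum λ i → section v (at G.Alphabet i)

      slice-nonneg : GH.IsAssignment f → ∀ ω v β → 0# ≤ slice ω v β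
      slice-nonneg f-asg (u′ , α′) v β = KH.operator-nonneg
        (λ v′ β′ → GH.IsAssignment.nonneg f-asg (v , v′) (β , β′)) u′ α′

  -- The scalar inequality

  +-cancelˡ-≤ : ∀ z {x y} → z + x ≤ z + y → x ≤ y
  +-cancelˡ-≤ z {x} {y} h = +-cancelʳ-≤ z (begin
    x + z  ≈⟨ +-comm x z ⟩
    z + x  ≤⟨ h ⟩
    z + y  ≈⟨ +-comm z y ⟩
    y + z  ∎)

  -- With Y = √ T this is the bound X ≤ φ T * N.  For Y ≉ 0# take s = Y and
  -- r = 1# in the first hypothesis.  For Y ≈ 0# also M ≤ 0#, so its right-hand
  -- side is at most K * s ², and s = X, r = K + 1# give X ² ≤ 0#.
  average-bound : ∀ {X M N Y} → let K = N + N; T = Y ² in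
                  0# ≤ N → 0# ≤ M → 0# ≤ Y → T ≤ 1# →
                  (∀ s r → X * s * r + X * s * r + M * s ² ≤ M * r ² + K * s ²) →
                  M * (1# + T) ≤ K * T →
                  X * (1# + T) ≤ (Y + Y) * N
  average-bound {X} {M} {N} {Y} 0≤N 0≤M 0≤Y T≤1 tangent M-bound with Y ≈? 0#
  ... | no Y≉0 = *-cancelʳ-≤ 0<2Y (+-cancelʳ-≤ (M * (1# + T) * T) (begin
      X * (1# + T) * (Y + Y) + M * (1# + T) * T
        ≈⟨ solve 4 (λ X Y M p → X :* p :* (Y :+ Y) :+ M :* p :* (Y :* Y)
             := (X :* Y :* con 1 :+ X :* Y :* con 1 :+ M :* (Y :* Y)) :* p) refl X Y M (1# + T) ⟩
      (X * Y * 1# + X * Y * 1# + M * T) * (1# + T)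
        ≤⟨ *-monoʳ-≤ 0≤1+T (tangent Y 1#) ⟩
      (M * 1# ² + K * T) * (1# + T)
        ≈⟨ solve 3 (λ M L p → (M :* (con 1 :* con 1) :+ L) :* p
             := M :* p :* con 1 :+ L :* p) refl M (K * T) (1# + T) ⟩
      M * (1# + T) * 1# + K * T * (1# + T)
        -- Once the part with factor `T` cancels, `M * (1# + T)` is left with the coefficient `g`,
        -- that is `1 - T`. It is nonnegative, so `M-bound` applies, and `g + (1# + T)` equals
        -- `1# + 1#`.
        ≈⟨ +-congʳ (*-congˡ 1≈T+g) ⟩
      M * (1# + T) * (T + g) + K * T * (1# + T)
        ≈⟨ solve 4 (λ A T g L → A :* (T :+ g) :+ L
             := A :* g :+ (L :+ A :* T)) refl (M * (1# + T)) T g (K * T * (1# + T)) ⟩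
      M * (1# + T) * g + (K * T * (1# + T) + M * (1# + T) * T)
        ≤⟨ +-monoˡ-≤ _ (*-monoʳ-≤ 0≤g M-bound) ⟩
      K * T * g + (K * T * (1# + T) + M * (1# + T) * T)
        ≈⟨ solve 4 (λ L g T Z → L :* g :+ (L :* (con 1 :+ T) :+ Z) := L :* (con 1 :+ (T :+ g)) :+ Z) refl
             (K * T) g T (M * (1# + T) * T) ⟩
      K * T * (1# + (T + g)) + M * (1# + T) * T
        ≈⟨ +-congʳ (*-congˡ (+-congˡ 1≈T+g)) ⟨
      K * T * (1# + 1#) + M * (1# + T) * T
        ≈⟨ +-congʳ (solve 2 (λ N Y → (N :+ N) :* (Y :* Y) :* (con 1 :+ con 1)
             := (Y :+ Y) :* N :* (Y :+ Y)) refl N Y) ⟩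
      (Y + Y) * N * (Y + Y) + M * (1# + T) * T  ∎))
    where
    K T : R
    K = N + N
    T = Y ²
    0<2Y : 0# < Y + Y
    0<2Y = +-pos (0≤Y , λ 0≈Y → Y≉0 (sym 0≈Y)) 0≤Y
    0≤1+T : 0# ≤ 1# + T
    0≤1+T = +-nonneg 0≤1 (²-nonneg Y)
    gap : ∃[ g ] (0# ≤ g × 1# ≈ T + g)
    gap = ≤⇒difference T≤1
    g : R
    g = proj₁ gap
    0≤g : 0# ≤ g
    0≤g = proj₁ (proj₂ gap)
    1≈T+g : 1# ≈ T + g
    1≈T+g = proj₂ (proj₂ gap)
  ... | yes Y≈0 = begin
      X * (1# + T)
        ≤⟨ *-monoʳ-≤ (+-nonneg 0≤1 (²-nonneg Y)) (²-cancel-≤ ≤-refl (≤-trans X²≤0 (≤-reflexive (sym (zeroˡ 0#))))) ⟩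
      0# * (1# + T)     ≈⟨ zeroˡ _ ⟩
      0#                ≤⟨ *-nonneg (+-nonneg 0≤Y 0≤Y) 0≤N ⟩
      (Y + Y) * N       ∎
    where
    K T r : R
    K = N + N
    T = Y ²
    r = K + 1#
    0≤K : 0# ≤ K
    0≤K = +-nonneg 0≤N 0≤N
    T≈0 : T ≈ 0#
    T≈0 = trans (*-congʳ Y≈0) (zeroˡ Y)
    M≤0 : M ≤ 0#
    M≤0 = begin
      M             ≤⟨ 0≤⇒≤+ (*-nonneg 0≤M (²-nonneg Y)) ⟩
      M + M * T     ≈⟨ +-congʳ (*-identityʳ M) ⟨
      M * 1# + M * T ≈⟨ distribˡ M 1# T ⟨
      M * (1# + T)  ≤⟨ M-bound ⟩
      K * T         ≈⟨ trans (*-congˡ T≈0) (zeroʳ K) ⟩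
      0#            ∎
    X²≤0 : X ² ≤ 0#
    X²≤0 = +-cancelʳ-≤ (K * X ²) (begin
      X ² + K * X ²
        ≤⟨ 0≤⇒≤+ (+-nonneg (*-nonneg (+-nonneg 0≤K 0≤1) (²-nonneg X)) (*-nonneg 0≤M (²-nonneg X))) ⟩
      X ² + K * X ² + (r * X ² + M * X ²)
        ≈⟨ solve 3 (λ X K M → X :* X :+ K :* (X :* X) :+ ((K :+ con 1) :* (X :* X) :+ M :* (X :* X))
                                               := X :* X :* (K :+ con 1) :+ X :* X :* (K :+ con 1) :+ M :* (X :* X)) refl X K M ⟩
      X * X * r + X * X * r + M * X ²      ≤⟨ tangent X r ⟩
      M * r ² + K * X ²                    ≤⟨ +-monoˡ-≤ _ (*-monoʳ-≤ (²-nonneg r) M≤0) ⟩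
      0# * r ² + K * X ²                   ≈⟨ +-congʳ (zeroˡ _) ⟩
      0# + K * X ²                         ∎)

  -- The tangent at D = (N + N) / p of the convex function (N + N) / d.
  reciprocal-tangent : ∀ {m q y N p} → let K = N + N in
                       0# ≤ m → 0# ≤ q → 0# ≤ y → 0# ≤ N → m + q ≤ K → m ≤ y * q →
                       K * p + K * p + m * p ² ≤ (y + 1#) * K + K * p ²
  reciprocal-tangent {m} {q} {y} {N} {p} 0≤m 0≤q 0≤y 0≤N m+q≤K m≤yq with ≤⇒difference m+q≤K
  ... | δ , 0≤δ , K≈m+q+δ = begin
      K * p + K * p + m * p ²
        ≤⟨ +-monoˡ-≤ _ (am-gm (*-nonneg (+-nonneg 0≤y 0≤1) 0≤K) (*-nonneg 0≤d (²-nonneg p)) (begin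
        (K * p) ²
          ≈⟨ solve 2 (λ K p → (K :* p) :* (K :* p) := K :* (K :* (p :* p))) refl K p ⟩
        K * (K * p ²)                    ≤⟨ *-monoʳ-≤ (*-nonneg 0≤K (²-nonneg p)) K≤zd ⟩
        (y + 1#) * d * (K * p ²)
          ≈⟨ solve 4 (λ z d K P → z :* d :* (K :* P) := (z :* K) :* (d :* P)) refl (y + 1#) d K (p ²) ⟩
        (y + 1#) * K * (d * p ²)         ∎)) ⟩
      (y + 1#) * K + d * p ² + m * p ²
        ≈⟨ solve 4 (λ A d m P → A :+ d :* P :+ m :* P := A :+ (m :+ d) :* P) refl ((y + 1#) * K) d m (p ²) ⟩
      (y + 1#) * K + (m + d) * p ²       ≈⟨ +-congˡ (*-congʳ K≈m+d) ⟨
      (y + 1#) * K + K * p ²             ∎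
    where
    K d : R
    K = N + N
    -- `d` is `K - m`. As `q ≤ d`, the hypothesis `m ≤ y * q` gives `K ≤ (y + 1#) * d`, so `y + 1#`
    -- dominates the convex function `K / d`.
    d = q + δ
    0≤K : 0# ≤ K
    0≤K = +-nonneg 0≤N 0≤N
    0≤d : 0# ≤ d
    0≤d = +-nonneg 0≤q 0≤δ
    K≈m+d : K ≈ m + d
    K≈m+d = trans K≈m+q+δ (+-assoc m q δ)
    K≤zd : K ≤ (y + 1#) * d
    K≤zd = begin
      K              ≈⟨ K≈m+d ⟩
      m + d          ≤⟨ +-monoˡ-≤ d (≤-trans m≤yq (*-monoˡ-≤ 0≤y (0≤⇒≤+ 0≤δ))) ⟩
      y * d + d      ≈⟨ solve 2 (λ y d → y :* d :+ d := (y :+ con 1) :* d) refl y d ⟩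
      (y + 1#) * d   ∎

  module Average {n} (c : Fin n → R) (0≤c : ∀ i → 0# ≤ c i) (∑c≈1 : sum c ≈ 1#) where

    average : (Fin n → R) → R
    average f = sum λ i → c i * f i

    average-mono : ∀ {f g : Fin n → R} → (∀ i → f i ≤ g i) → average f ≤ average g
    average-mono f≤g = sum-mono λ i → *-monoˡ-≤ (0≤c i) (f≤g i)

    average-+ : ∀ f g → average (λ i → f i + g i) ≈ average f + average g
    average-+ f g = trans (sum-cong-≋ λ i → distribˡ (c i) (f i) (g i)) (∑-distrib-+ (λ i → c i * f i) (λ i → c i * g i))

    average-*ʳ : ∀ f k → average (λ i → f i * k) ≈ average f * k
    average-*ʳ f k = trans (sum-cong-≋ λ i → sym (*-assoc (c i) (f i) k)) (sym (*-distribʳ-sum k λ i → c i * f i))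

    average-const : ∀ k → average (λ _ → k) ≈ k
    average-const k = trans (sym (*-distribʳ-sum k c)) (trans (*-congʳ ∑c≈1) (*-identityˡ k))

    -- For fixed `s`, `r` and for the fixed slope `1# + T`, the pointwise inequalities are linear in
    -- `x`, `m`, `q` and `y`, so they survive averaging and become the hypotheses of
    -- `average-bound`. The condition on all `s` and `r` is a form of `x ² ≤ m * q` without square
    -- roots.
    averaged-bound : ∀ {m q x y : Fin n → R} {N Y} → let K = N + N; T = Y ² in
      (∀ i → 0# ≤ m i) → (∀ i → 0# ≤ q i) → (∀ i → 0# ≤ y i) → 0# ≤ N → 0# ≤ Y → T ≤ 1# →
      (∀ i → m i + q i ≤ K) → (∀ i → m i ≤ y i * q i) →
      (∀ i s r → x i * s * r + x i * s * r ≤ m i * r ² + q i * s ²) →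
      average y ≤ T → average x * (1# + T) ≤ (Y + Y) * N
    averaged-bound {m} {q} {x} {y} {N} {Y} 0≤m 0≤q 0≤y 0≤N 0≤Y T≤1 m+q≤K m≤yq xsr≤ y≤T =
      average-bound 0≤N 0≤M 0≤Y T≤1 tangent M-bound
      where
      K T p X M : R
      K = N + N
      T = Y ²
      p = 1# + T
      X = average x
      M = average m
      0≤K : 0# ≤ K
      0≤K = +-nonneg 0≤N 0≤N
      0<p : 0# < p
      0<p = +-pos 0<1 (²-nonneg Y)
      0≤M : 0# ≤ M
      0≤M = sum-nonneg λ i → *-nonneg (0≤c i) (0≤m i)

      tangent : ∀ s r → X * s * r + X * s * r + M * s ² ≤ M * r ² + K * s ²
      tangent s r = begin
        X * s * r + X * s * r + M * s ²
          ≈⟨ solve 4 (λ X s r Z → X :* s :* r :+ X :* s :* r :+ Z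
               := X :* (s :* r :+ s :* r) :+ Z) refl X s r (M * s ²) ⟩
        X * (s * r + s * r) + M * s ²
          ≈⟨ trans (average-+ _ _) (+-cong (average-*ʳ x (s * r + s * r)) (average-*ʳ m (s ²))) ⟨
        average (λ i → x i * (s * r + s * r) + m i * s ²)
          ≤⟨ average-mono (λ i → begin
               x i * (s * r + s * r) + m i * s ²
                 ≈⟨ solve 4 (λ X s r Z → X :* (s :* r :+ s :* r) :+ Z
                      := X :* s :* r :+ X :* s :* r :+ Z) refl (x i) s r (m i * s ²) ⟩
               x i * s * r + x i * s * r + m i * s ²   ≤⟨ +-monoˡ-≤ _ (xsr≤ i s r) ⟩
               m i * r ² + q i * s ² + m i * s ²
                 ≈⟨ solve 4 (λ A m q S → A :+ q :* S :+ m :* S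
                      := A :+ (m :+ q) :* S) refl (m i * r ²) (m i) (q i) (s ²) ⟩
               m i * r ² + (m i + q i) * s ²           ≤⟨ +-monoʳ-≤ _ (*-monoʳ-≤ (²-nonneg s) (m+q≤K i)) ⟩
               m i * r ² + K * s ²                     ∎) ⟩
        average (λ i → m i * r ² + K * s ²)
          ≈⟨ trans (average-+ _ _) (+-cong (average-*ʳ m (r ²)) (average-const (K * s ²))) ⟩
        M * r ² + K * s ²  ∎

      -- Jensen's inequality by tangents. The slope `p = 1# + T` puts the point of tangency at
      -- `m = K * T / p`, which is exactly the bound claimed for `M`.
      M-bound : M * p ≤ K * T
      M-bound = *-cancelʳ-≤ 0<p (+-cancelˡ-≤ (K * p + K * p) (begin
        K * p + K * p + M * p * p
          ≈⟨ +-congˡ (*-assoc M p p) ⟩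
        K * p + K * p + M * p ²
          ≈⟨ trans (average-+ _ _) (+-cong (average-const (K * p + K * p)) (average-*ʳ m (p ²))) ⟨
        average (λ i → K * p + K * p + m i * p ²)
          ≤⟨ average-mono (λ i → reciprocal-tangent (0≤m i) (0≤q i) (0≤y i) 0≤N (m+q≤K i) (m≤yq i)) ⟩
        average (λ i → (y i + 1#) * K + K * p ²)
          ≈⟨ trans (average-+ _ _) (+-cong
               (trans (average-*ʳ (λ i → y i + 1#) K) (*-congʳ (trans (average-+ y (λ _ → 1#)) (+-congˡ (average-const 1#)))))
               (average-const (K * p ²))) ⟩
        (average y + 1#) * K + K * p ²
          ≤⟨ +-monoˡ-≤ _ (*-monoʳ-≤ 0≤K (+-monoˡ-≤ 1# y≤T)) ⟩
        (T + 1#) * K + K * p ²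
          ≈⟨ solve 2 (λ T K → (T :+ con 1) :* K :+ K :* ((con 1 :+ T) :* (con 1 :+ T))
               := K :* (con 1 :+ T) :+ K :* (con 1 :+ T) :+ K :* T :* (con 1 :+ T)) refl T K ⟩
        K * p + K * p + K * T * p  ∎))

  -- The rounding bound

  FinSet : ℕ → FiniteSet
  FinSet n = record { Carrier = Fin n ; size = n ; enum = ↔-refl }

  module Vectors (G : ProjectionGame) where
    open ProjectionGame G
    open Maximum G using (Table)
    open Race G
    open Kernel G

    Factorisation : Row → Set
    Factorisation g = ∃[ r ] ((∀ β → 0# ≤ r β) × ∑ Alphabet r ≈ 1# × (∀ β → g β ≈ ∑ Alphabet g * r β))

    -- Divide by the mass if it is nonzero. Otherwise nonnegativity makes the row vanish, and the
    -- point mass at `letter` serves as the probability row.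
    factor-row : ∀ g → (∀ β → 0# ≤ g β) → Factorisation g
    factor-row g 0≤g with ∑ Alphabet g ≈? 0#
    ... | no k≉0 = (λ β → k ⁻¹ * g β)
                 , (λ β → *-nonneg (proj₁ (⁻¹-pos 0<k)) (0≤g β))
                 , trans (sym (*-distribˡ-sum (k ⁻¹) (g ∘ at Alphabet))) (trans (*-comm _ _) (*-inverseʳ k k≉0))
                 , λ β → sym (trans (sym (*-assoc k (k ⁻¹) (g β))) (trans (*-congʳ (*-inverseʳ k k≉0)) (*-identityˡ (g β))))
      where
      k : R
      k = ∑ Alphabet g
      0<k : 0# < k
      0<k = sum-nonneg (λ i → 0≤g (at Alphabet i)) , λ 0≈k → k≉0 (sym 0≈k)
    ... | yes k≈0 = (λ β → 1# when FiniteSet._≟_ Alphabet letter β)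
                  , (λ β → when-nonneg (FiniteSet._≟_ Alphabet letter β) 0≤1)
                  , ∑-δ Alphabet letter
                  , λ β → trans (antisym (≤-trans (≤∑ β) (≤-reflexive k≈0)) (0≤g β)) (sym (trans (*-congʳ k≈0) (zeroˡ _)))
      where
      ≤∑ : ∀ β → g β ≤ ∑ Alphabet g
      ≤∑ β = ≡.subst (λ γ → g γ ≤ ∑ Alphabet g) (FiniteSet.at-index Alphabet β)
        (term≤sum (λ i → 0≤g (at Alphabet i)) (FiniteSet.index Alphabet β))

    -- h is read as an assignment whose values are functions on Ω, weighted by ν.
    module _ (Ω : FiniteSet) (ν : ∣ Ω ∣ → R) (0≤ν : ∀ ω → 0# ≤ ν ω)
             (h : ∣ Ω ∣ → Table) (0≤h : ∀ ω v β → 0# ≤ h ω v β) where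

      mass mass² : ∣ Ω ∣ → ∣ V ∣ → R
      mass  ω v = ∑ Alphabet (h ω v)
      mass² ω v = mass ω v ²

      factored : ∀ ω v → Factorisation (h ω v)
      factored ω v = factor-row (h ω v) (0≤h ω v)

      direction : ∣ Ω ∣ → Table
      direction ω v = proj₁ (factored ω v)

      direction-isAssignment : ∀ ω → IsAssignment (direction ω)
      direction-isAssignment ω = record
        { nonneg     = λ v → proj₁ (proj₂ (factored ω v))
        ; normalised = λ v → proj₁ (proj₂ (proj₂ (factored ω v)))
        }

      h-factored : ∀ ω v β → h ω v β ≈ mass ω v * direction ω v β
      h-factored ω v = proj₂ (proj₂ (proj₂ (factored ω v)))

      mass²-layers : ∀ ω → Layers (FiniteSet.size V) (mass² ω)
      mass²-layers ω = layersᶠ V (mass² ω) λ v → ²-nonneg (mass ω v)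

      Layer : FiniteSet
      Layer = FinSet (FiniteSet.size V)

      partial : ∣ Ω ×ᶠ Layer ∣ → PartialAssignment
      partial (ω , l) = record
        { weight           = ν ω * Layers.weight (mass²-layers ω) l
        ; weight-nonneg    = *-nonneg (0≤ν ω) (Layers.weight-nonneg (mass²-layers ω) l)
        ; covers           = Cover.covers (mass²-layers ω) l
        ; row              = direction ω
        ; row-isAssignment = direction-isAssignment ω
        }

      partials : Fin (FiniteSet.size (Ω ×ᶠ Layer)) → PartialAssignment
      partials = partial ∘ at (Ω ×ᶠ Layer)

      agreement : ∣ Pair ∣ → R
      agreement i = race partials λ b → collide b i

      small large : ∣ Ω ∣ → ∣ Pair ∣ → R
      small ω (u , e , e′) = Cover.both   (mass²-layers ω) (tgt e) (tgt e′)
      large ω (u , e , e′) = Cover.either (mass²-layers ω) (tgt e) (tgt e′)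

      -- For a pair of edges, `same` and `correlation` are `m` and `x` of the outline, and
      -- `agreement` is `y`. The weight `covered` takes the place of `2N - m`, which bounds it from
      -- above by `same+covered`.
      same covered correlation : ∣ Pair ∣ → R
      same        i = ∑ Ω λ ω → ν ω * (small ω i * collide (direction ω) i)
      covered     i = ∑ Ω λ ω → ν ω * large ω i
      correlation i = ∑ Ω λ ω → ν ω * collide (h ω) i

      small-nonneg : ∀ ω i → 0# ≤ small ω i
      small-nonneg ω (u , e , e′) = Cover.both-nonneg (mass²-layers ω) (tgt e) (tgt e′)

      large-nonneg : ∀ ω i → 0# ≤ large ω i
      large-nonneg ω (u , e , e′) = Cover.either-nonneg (mass²-layers ω) (tgt e) (tgt e′)

      same-nonneg : ∀ i → 0# ≤ same i
      same-nonneg i = sum-nonneg λ k → *-nonneg (0≤ν (at Ω k))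
        (*-nonneg (small-nonneg (at Ω k) i) (collide-nonneg (direction-isAssignment (at Ω k)) i))

      covered-nonneg : ∀ i → 0# ≤ covered i
      covered-nonneg i = sum-nonneg λ k → *-nonneg (0≤ν (at Ω k)) (large-nonneg (at Ω k) i)

      agreement-nonneg : ∀ i → 0# ≤ agreement i
      agreement-nonneg i = race-lower partials (λ b b-asg → collide-nonneg b-asg i)

      -- This is `race-agreement` for `partials`. All layers of `ω` share the rows `direction ω`, so
      -- summing over the layers leaves `small ω` and `large ω`.
      same≤agreement*covered : ∀ i → same i ≤ agreement i * covered i
      same≤agreement*covered i@(u , e , e′) = begin
        same i
          ≈⟨ trans (∑-× Ω Layer λ j → weight (partial j) * both (partial j)) (sum-cong-≋ λ k → begin-equality
               (sum λ l → ν (at Ω k) * w k l * (χ (c k l (tgt e) ∧ c k l (tgt e′)) * a k))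
                 ≈⟨ sum-cong-≋ (λ l → solve 4 (λ n w x a → n :* w :* (x :* a) := n :* (w :* x :* a)) refl
                      (ν (at Ω k)) (w k l) (χ (c k l (tgt e) ∧ c k l (tgt e′))) (a k)) ⟩
               (sum λ l → ν (at Ω k) * (w k l * χ (c k l (tgt e) ∧ c k l (tgt e′)) * a k))
                 ≈⟨ *-distribˡ-sum (ν (at Ω k)) (λ l → w k l * χ (c k l (tgt e) ∧ c k l (tgt e′)) * a k) ⟨
               ν (at Ω k) * (sum λ l → w k l * χ (c k l (tgt e) ∧ c k l (tgt e′)) * a k)
                 ≈⟨ *-congˡ (*-distribʳ-sum (a k) λ l → w k l * χ (c k l (tgt e) ∧ c k l (tgt e′))) ⟨
               ν (at Ω k) * (small (at Ω k) i * a k)  ∎) ⟨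
        ∑both partials
          ≤⟨ race-agreement partials (λ b → collide b i) (λ b _ → ≤-refl) ⟩
        agreement i * ∑either partials
          ≈⟨ *-congˡ (trans (∑-× Ω Layer λ j → weight (partial j) * either (partial j)) (sum-cong-≋ λ k → begin-equality
               (sum λ l → ν (at Ω k) * w k l * χ (c k l (tgt e) ∨ c k l (tgt e′)))
                 ≈⟨ sum-cong-≋ (λ l → *-assoc (ν (at Ω k)) (w k l) (χ (c k l (tgt e) ∨ c k l (tgt e′)))) ⟩
               (sum λ l → ν (at Ω k) * (w k l * χ (c k l (tgt e) ∨ c k l (tgt e′))))
                 ≈⟨ *-distribˡ-sum (ν (at Ω k)) (λ l → w k l * χ (c k l (tgt e) ∨ c k l (tgt e′))) ⟨
               ν (at Ω k) * large (at Ω k) i  ∎)) ⟩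
        agreement i * covered i  ∎
        where
        open PartialAssignment using (weight)
        open Agreement (tgt e) (tgt e′) (collision e e′) (λ b b-asg → collide-nonneg b-asg i)
        w : ∀ k → Fin (FiniteSet.size V) → R
        w k = Layers.weight (mass²-layers (at Ω k))
        c : ∀ k → Fin (FiniteSet.size V) → ∣ V ∣ → Bool
        c k = Cover.covers (mass²-layers (at Ω k))
        a : Fin (FiniteSet.size Ω) → R
        a k = collide (direction (at Ω k)) i

      collide-h : ∀ ω u e e′ → collide (h ω) (u , e , e′) ≈ mass ω (tgt e) * mass ω (tgt e′) * collide (direction ω) (u , e , e′)
      collide-h ω u e e′ = trans
        (collision-cong e e′ (h-factored ω (tgt e)) (h-factored ω (tgt e′)))
        (collision-* e e′ (mass ω (tgt e)) (mass ω (tgt e′)) (direction ω (tgt e)) (direction ω (tgt e′)))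

      -- A Cauchy-Schwarz bound over `ω` in tangent form. For each `ω` the product of the two masses
      -- is the geometric mean of `small` and `large`, so AM-GM applies to these with the factors
      -- `r ²` and `s ²`.
      correlation-tangent : ∀ i s r → correlation i * s * r + correlation i * s * r ≤ same i * r ² + covered i * s ²
      correlation-tangent i@(u , e , e′) s r = begin
        correlation i * s * r + correlation i * s * r
          ≈⟨ solve 3 (λ x s r → x :* s :* r :+ x :* s :* r
               := x :* (s :* r :+ s :* r)) refl (correlation i) s r ⟩
        correlation i * (s * r + s * r)
          ≈⟨ *-distribʳ-sum (s * r + s * r) (λ k → ν (at Ω k) * collide (h (at Ω k)) i) ⟩
        (∑ Ω λ ω → ν ω * collide (h ω) i * (s * r + s * r))
          ≤⟨ sum-mono (λ k → at-ω (at Ω k)) ⟩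
        (∑ Ω λ ω → ν ω * (small ω i * collide (direction ω) i) * r ² + ν ω * large ω i * s ²)
          ≈⟨ ∑-distrib-+ (λ k → ν (at Ω k) * (small (at Ω k) i * collide (direction (at Ω k)) i) * r ²)
                            (λ k → ν (at Ω k) * large (at Ω k) i * s ²) ⟩
        (∑ Ω λ ω → ν ω * (small ω i * collide (direction ω) i) * r ²) + (∑ Ω λ ω → ν ω * large ω i * s ²)
          ≈⟨ +-cong (*-distribʳ-sum (r ²) λ k → ν (at Ω k) * (small (at Ω k) i * collide (direction (at Ω k)) i))
                    (*-distribʳ-sum (s ²) λ k → ν (at Ω k) * large (at Ω k) i) ⟨
        same i * r ² + covered i * s ²  ∎
        where
        at-ω : ∀ ω → ν ω * collide (h ω) i * (s * r + s * r)
                     ≤ ν ω * (small ω i * collide (direction ω) i) * r ² + ν ω * large ω i * s ²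
        at-ω ω = begin
          ν ω * collide (h ω) i * (s * r + s * r)
            ≈⟨ *-congʳ (*-congˡ (collide-h ω u e e′)) ⟩
          ν ω * (k * k′ * a) * (s * r + s * r)
            ≈⟨ solve 6 (λ n k k′ a s r → n :* (k :* k′ :* a) :* (s :* r :+ s :* r)
                 := n :* a :* (k :* k′ :* s :* r :+ k :* k′ :* s :* r)) refl (ν ω) k k′ a s r ⟩
          ν ω * a * (k * k′ * s * r + k * k′ * s * r)
            ≤⟨ *-monoˡ-≤ (*-nonneg (0≤ν ω) 0≤a)
               (am-gm (*-nonneg (small-nonneg ω i) (²-nonneg r)) (*-nonneg (large-nonneg ω i) (²-nonneg s)) (begin
                 (k * k′ * s * r) ²
                   ≈⟨ solve 4 (λ k k′ s r → (k :* k′ :* s :* r) :* (k :* k′ :* s :* r)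
                        := (k :* k) :* (k′ :* k′) :* ((r :* r) :* (s :* s))) refl k k′ s r ⟩
                 mass² ω (tgt e) * mass² ω (tgt e′) * (r ² * s ²)
                   ≈⟨ *-congʳ (Cover.both-*-either (mass²-layers ω) (tgt e) (tgt e′)) ⟨
                 small ω i * large ω i * (r ² * s ²)
                   ≈⟨ solve 4 (λ b e r s → b :* e :* (r :* s)
                        := (b :* r) :* (e :* s)) refl (small ω i) (large ω i) (r ²) (s ²) ⟩
                 small ω i * r ² * (large ω i * s ²)  ∎)) ⟩
          ν ω * a * (small ω i * r ² + large ω i * s ²)
            ≈⟨ solve 6 (λ n a b e r s → n :* a :* (b :* r :+ e :* s)
                 := n :* (b :* a) :* r :+ n :* e :* s :* a) refl
                 (ν ω) a (small ω i) (large ω i) (r ²) (s ²) ⟩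
          ν ω * (small ω i * a) * r ² + ν ω * large ω i * s ² * a
            -- The collision probability `a` is at most `1#` and is dropped from the `large` term
            -- only, since `covered` does not ask for agreement.
            ≤⟨ +-monoʳ-≤ _ (*-monoˡ-≤ (*-nonneg (*-nonneg (0≤ν ω) (large-nonneg ω i)) (²-nonneg s))
                              (collide-≤1 (direction-isAssignment ω) i)) ⟩
          ν ω * (small ω i * a) * r ² + ν ω * large ω i * s ² * 1#
            ≈⟨ +-congˡ (*-identityʳ _) ⟩
          ν ω * (small ω i * a) * r ² + ν ω * large ω i * s ²  ∎
          where
          k k′ a : R
          k = mass ω (tgt e)
          k′ = mass ω (tgt e′)
          a = collide (direction ω) i
          0≤a : 0# ≤ a
          0≤a = collide-nonneg (direction-isAssignment ω) i

      module _ {N} (bounded : ∀ v → (∑ Ω λ ω → ν ω * mass² ω v) ≤ N) where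

        -- Agreement is at most `1#`, and `small` and `large` add up to the two squared masses, each
        -- of which has weighted sum at most `N`.
        same+covered : ∀ i → same i + covered i ≤ N + N
        same+covered i@(u , e , e′) = begin
          same i + covered i
            ≈⟨ ∑-distrib-+ (λ k → ν (at Ω k) * (small (at Ω k) i * collide (direction (at Ω k)) i))
                            (λ k → ν (at Ω k) * large (at Ω k) i) ⟨
          (∑ Ω λ ω → ν ω * (small ω i * collide (direction ω) i) + ν ω * large ω i)
            ≤⟨ sum-mono (λ k → at-ω (at Ω k)) ⟩
          (∑ Ω λ ω → ν ω * mass² ω (tgt e) + ν ω * mass² ω (tgt e′))
            ≈⟨ ∑-distrib-+ (λ k → ν (at Ω k) * mass² (at Ω k) (tgt e)) (λ k → ν (at Ω k) * mass² (at Ω k) (tgt e′)) ⟩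
          (∑ Ω λ ω → ν ω * mass² ω (tgt e)) + (∑ Ω λ ω → ν ω * mass² ω (tgt e′))
            ≤⟨ +-mono-≤ (bounded (tgt e)) (bounded (tgt e′)) ⟩
          N + N  ∎
          where
          at-ω : ∀ ω → ν ω * (small ω i * collide (direction ω) i) + ν ω * large ω i ≤ ν ω * mass² ω (tgt e) + ν ω * mass² ω (tgt e′)
          at-ω ω = begin
            ν ω * (small ω i * collide (direction ω) i) + ν ω * large ω i
              ≤⟨ +-monoˡ-≤ _ (*-monoˡ-≤ (0≤ν ω) (*-monoˡ-≤ (small-nonneg ω i) (collide-≤1 (direction-isAssignment ω) i))) ⟩
            ν ω * (small ω i * 1#) + ν ω * large ω i    ≈⟨ +-congʳ (*-congˡ (*-identityʳ _)) ⟩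
            ν ω * small ω i + ν ω * large ω i           ≈⟨ distribˡ _ _ _ ⟨
            ν ω * (small ω i + large ω i)
              ≈⟨ *-congˡ (Cover.both-+-either (mass²-layers ω) (tgt e) (tgt e′)) ⟩
            ν ω * (mass² ω (tgt e) + mass² ω (tgt e′))  ≈⟨ distribˡ _ _ _ ⟩
            ν ω * mass² ω (tgt e) + ν ω * mass² ω (tgt e′)  ∎

        -- The bound by `φ (Y ²) * N` with its denominator cleared, obtained by applying
        -- `averaged-bound` to the distribution `PrPair`.
        vector-bound : ∀ {Y} → 0# ≤ N → 0# ≤ Y → Y ² ≤ 1# →
                       (∀ b → IsAssignment b → norm² (operator b) ≤ Y ²) →
                       (∑ Ω λ ω → ν ω * norm² (operator (h ω))) * (1# + Y ²) ≤ (Y + Y) * N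
        vector-bound {Y} 0≤N 0≤Y T≤1 value≤T = begin
          (∑ Ω λ ω → ν ω * norm² (operator (h ω))) * (1# + Y ²)
            ≈⟨ *-congʳ norm²≈correlation ⟩
          average (correlation ∘ at Pair) * (1# + Y ²)
            ≤⟨ averaged-bound (same-nonneg ∘ at Pair) (covered-nonneg ∘ at Pair) (agreement-nonneg ∘ at Pair) 0≤N 0≤Y T≤1
                 (same+covered ∘ at Pair) (same≤agreement*covered ∘ at Pair) (correlation-tangent ∘ at Pair) agreement≤T ⟩
          (Y + Y) * N  ∎
          where
          open Average (PrPair ∘ at Pair) (PrPair-nonneg ∘ at Pair) ∑PrPair
          norm²≈correlation : (∑ Ω λ ω → ν ω * norm² (operator (h ω))) ≈ average (correlation ∘ at Pair)
          norm²≈correlation = begin-equality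
            (∑ Ω λ ω → ν ω * norm² (operator (h ω)))
              ≈⟨ sum-cong-≋ (λ k → trans (*-congˡ {ν (at Ω k)} (norm²-operator (h (at Ω k))))
                   (*-distribˡ-sum (ν (at Ω k)) λ j → PrPair (at Pair j) * collide (h (at Ω k)) (at Pair j))) ⟩
            (∑ Ω λ ω → ∑ Pair λ i → ν ω * (PrPair i * collide (h ω) i))
              ≈⟨ ∑-swap Ω Pair (λ ω i → ν ω * (PrPair i * collide (h ω) i)) ⟩
            (∑ Pair λ i → ∑ Ω λ ω → ν ω * (PrPair i * collide (h ω) i))
              ≈⟨ sum-cong-≋ (λ j → trans
                   (sum-cong-≋ λ k → solve 3 (λ n p c → n :* (p :* c) := p :* (n :* c)) refl
                     (ν (at Ω k)) (PrPair (at Pair j)) (collide (h (at Ω k)) (at Pair j)))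
                   (sym (*-distribˡ-sum (PrPair (at Pair j)) λ k → ν (at Ω k) * collide (h (at Ω k)) (at Pair j)))) ⟩
            average (correlation ∘ at Pair)  ∎
          -- Exchanging race and average gives the expected squared norm of the rounded assignment;
          -- every outcome is an assignment, so `value≤T` bounds it.
          agreement≤T : average (agreement ∘ at Pair) ≤ Y ²
          agreement≤T = begin
            average (agreement ∘ at Pair)
              ≈⟨ race-sum partials (PrPair ∘ at Pair) (λ j b → collide b (at Pair j)) ⟨
            race partials (λ b → ∑ Pair λ i → PrPair i * collide b i)
              ≤⟨ race-upper partials (λ b b-asg → ≤-trans (≤-reflexive (sym (norm²-operator b))) (value≤T b b-asg)) ⟩
            Y ²  ∎

  -- The squared collision value and the product bound

  module _ (G : ProjectionGame) where
    open ProjectionGame G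
    open Kernel G

    norm²-nonneg : ∀ g → 0# ≤ norm² g
    norm²-nonneg g = sum-nonneg λ i → *-nonneg (proj₁ (μU-pos (at U i))) (sum-nonneg λ j → ²-nonneg (g (at U i) (at Alphabet j)))

    ‖‖-nonneg : 0# ≤ ‖ G ‖
    ‖‖-nonneg with proj₁ (‖‖-isMaximum G)
    ... | f , _ , norm≈ = ≤-trans (√-nonneg (norm² (operator f))) (≤-reflexive norm≈)

    ‖‖²-attained : ∃[ f ] (IsAssignment f × ‖ G ‖ ² ≈ norm² (operator f))
    ‖‖²-attained with proj₁ (‖‖-isMaximum G)
    ... | f , f-asg , norm≈ = f , f-asg , trans (*-cong (sym norm≈) (sym norm≈)) (√-square (norm²-nonneg (operator f)))

    norm²≤‖‖² : ∀ f → IsAssignment f → norm² (operator f) ≤ ‖ G ‖ ²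
    norm²≤‖‖² f f-asg = begin
      norm² (operator f)   ≈⟨ √-square (norm²-nonneg (operator f)) ⟨
      norm (operator f) ²  ≤⟨ *-monoˡ-≤ (√-nonneg _) norm≤ ⟩
      norm (operator f) * ‖ G ‖ ≤⟨ *-monoʳ-≤ ‖‖-nonneg norm≤ ⟩
      ‖ G ‖ ²              ∎
      where
      norm≤ : norm (operator f) ≤ ‖ G ‖
      norm≤ = proj₂ (‖‖-isMaximum G) f f-asg

    -- For an optimal assignment the squared norm is an average of collision probabilities.
    ‖‖²≤1 : ‖ G ‖ ² ≤ 1#
    ‖‖²≤1 with ‖‖²-attained
    ... | f , f-asg , ‖G‖²≈ = begin
      ‖ G ‖ ²                              ≈⟨ ‖G‖²≈ ⟩
      norm² (operator f)                   ≈⟨ norm²-operator f ⟩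
      (∑ Pair λ i → PrPair i * collide f i)
        ≤⟨ sum-mono (λ j → *-monoˡ-≤ (PrPair-nonneg (at Pair j)) (collide-≤1 f-asg (at Pair j))) ⟩
      (∑ Pair λ i → PrPair i * 1#)         ≈⟨ sum-cong-≋ (λ j → *-identityʳ (PrPair (at Pair j))) ⟩
      ∑ Pair PrPair                        ≈⟨ ∑PrPair ⟩
      1#                                   ∎

  ‖⊗‖²-bound : ∀ G H → ‖ G ⊗ H ‖ ² ≤ φ (‖ G ‖ ²) * ‖ H ‖ ²
  ‖⊗‖²-bound G H with ‖‖²-attained (G ⊗ H)
  ... | f , f-asg , ‖GH‖²≈ = *-cancelʳ-≤ 0<p (begin
    ‖ G ⊗ H ‖ ² * p   ≈⟨ *-congʳ (trans ‖GH‖²≈ (norm²-⊗ f)) ⟩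
    (∑ (H.U ×ᶠ H.Alphabet) λ ω → H.μU (proj₁ ω) * G.norm² (G.operator (slice f ω))) * p
      ≤⟨ Vectors.vector-bound G (H.U ×ᶠ H.Alphabet) (H.μU ∘ proj₁) (λ ω → proj₁ (H.μU-pos (proj₁ ω)))
           (slice f) (slice-nonneg f f-asg) bounded
           (²-nonneg ‖ H ‖) (‖‖-nonneg G) (‖‖²≤1 G) (norm²≤‖‖² G) ⟩
    (‖ G ‖ + ‖ G ‖) * ‖ H ‖ ²
      -- Inserting `p * p ⁻¹` recovers the denominator of `φ`, and `√-of-square` its numerator.
      ≈⟨ *-identityʳ _ ⟨
    (‖ G ‖ + ‖ G ‖) * ‖ H ‖ ² * 1#
      ≈⟨ *-congˡ (*-inverseʳ p (0<⇒≉0 0<p)) ⟨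
    (‖ G ‖ + ‖ G ‖) * ‖ H ‖ ² * (p * p ⁻¹)
      ≈⟨ solve 4 (λ Y N p q → (Y :+ Y) :* N :* (p :* q)
           := (con 1 :+ con 1) :* Y :* q :* N :* p) refl ‖ G ‖ (‖ H ‖ ²) p (p ⁻¹) ⟩
    (1# + 1#) * ‖ G ‖ * p ⁻¹ * ‖ H ‖ ² * p
      ≈⟨ *-congʳ (*-congʳ (*-congʳ (*-congˡ (√-of-square (‖‖-nonneg G))))) ⟨
    φ (‖ G ‖ ²) * ‖ H ‖ ² * p  ∎)
    where
    module G = ProjectionGame G
    module H = ProjectionGame H
    open Slice G H
    p : R
    p = 1# + ‖ G ‖ ²
    0<p : 0# < p
    0<p = +-pos 0<1 (²-nonneg ‖ G ‖)
    -- The squared masses of the slices at `v` sum to the squared norm of `H` at `marginal f v`,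
    -- which is an assignment of `H`.
    bounded : ∀ v → (∑ (H.U ×ᶠ H.Alphabet) λ ω → H.μU (proj₁ ω) * ∑ G.Alphabet (slice f ω v) ²) ≤ ‖ H ‖ ²
    bounded v = ≤-trans (≤-reflexive (∑slice² f v)) (norm²≤‖‖² H _ (marginal-isAssignment f f-asg v))

theorem1p8 : (ℝ : CompleteOrderedField) →
    let open CompleteOrderedField ℝ
        open Games ℝ
    in (G H : ProjectionGame) →
       ‖ G ⊗ H ‖ ² ≤ φ (‖ G ‖ ²) * ‖ H ‖ ²
theorem1p8 ℝ = CollisionValue.‖⊗‖²-bound ℝ
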